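{- Any CONGEST algorithm (possibly randomized, succeeding with probability at least $2/3$) that, given a directed weighted $n$-vertex graph $G$, vertices $s,t$ and a shortest $s$-$t$ path $P_{st}$, solves the Replacement Paths problem, or the Second Simple Shortest Path problem, for $P_{st}$ requires $\Omega\!\left(\frac{n}{\log n}\right)$ rounds in the worst case; this holds even when restricted to input graphs whose undirected diameter is a constant.
   Context: CONGEST model: the communication network is the graph $G=(V,E)$, $n=|V|$; each node has a unique identifier in $\{0,\dots,n-1\}$, knows its own and its neighbours' identifiers and the weights of its incident edges (weights are integers in $\{0,1,\dots,W\}$ with $W=\mathrm{poly}(n)$); computation proceeds in synchronous rounds in which each node may send a message of $O(\log n)$ bits to each neighbour; local computation is free; communication links are bidirectional and unweighted even when $G$ is directed. Complexity is the number of rounds. The undirected diameter $D$ is the diameter of the underlying undirected unweighted graph of $G$. Replacement Paths (RPaths): given $G$, $s,t$, and a shortest $s$-$t$ path $P_{st}$, for each edge $e\in P_{st}$ some vertex must compute the weight of a shortest simple $s$-$t$ path $P_e$ avoiding $e$, and every vertex on $P_e$ must know its successor on $P_e$. Second Simple Shortest Path (2-SiSP): some vertex must compute the weight of a minimum-weight simple $s$-$t$ path not containing at least one edge of $P_{st}$, and each vertex on such a path must know its successor on it. -}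

module Defs where

open import Data.Bool using (Bool; if_then_else_; _∨_; T)
open import Data.Fin using (Fin; toℕ; finToFun)
open import Data.Fin.Subset using (Subset; ∣_∣) renaming (_∈_ to _∈ₛ_)
open import Data.List using (List; []; _∷_)
open import Data.List.Membership.Propositional using (_∈_; _∉_)
open import Data.List.Relation.Unary.Unique.Propositional using (Unique)
open import Data.Maybe using (Maybe; just; nothing; is-just)
open import Data.Nat using (ℕ; zero; suc; _+_; _*_; _^_; _≤_; NonZero)
open import Data.Nat.Logarithm using (⌈log₂_⌉)
open import Data.Product using (Σ; ∃; _×_; _,_)
open import Data.Sum using (_⊎_)
open import Data.Vec using (Vec; lookup; tabulate)
open import Data.Vec.Bounded using (Vec≤)
open import Relation.Binary.Construct.Closure.ReflexiveTransitive using (Star; ε; _◅_)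
open import Relation.Binary.PropositionalEquality using (_≡_)
open import Relation.Nullary using (¬_)

-- Simple digraphs whose edge weights are integers in {0,…,W}; a vertex is
-- its own identifier.  The weight matrix is first-order data (not a function),
-- so that graphs with the same entries are propositionally equal.
record Digraph (n W : ℕ) : Set where
  field
    matrix   : Vec (Vec (Maybe (Fin (suc W))) n) n
    loopless : ∀ v → lookup (lookup matrix v) v ≡ nothing

  entry : Fin n → Fin n → Maybe (Fin (suc W))
  entry u v = lookup (lookup matrix u) v

  Edge : Fin n → Fin n → Set
  Edge u v = ∃ λ w → entry u v ≡ just w

  Walk : Fin n → Fin n → Set
  Walk = Star Edge

  linked : Fin n → Fin n → Bool
  linked u v = is-just (entry u v) ∨ is-just (entry v u)

  Link : Fin n → Fin n → Set
  Link u v = T (linked u v)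

module _ {n : ℕ} {R : Fin n → Fin n → Set} where

  length : ∀ {u v} → Star R u v → ℕ
  length ε       = 0
  length (_ ◅ p) = suc (length p)

  vertices : ∀ {u v} → Star R u v → List (Fin n)
  vertices {u} ε       = u ∷ []
  vertices {u} (_ ◅ p) = u ∷ vertices p

  edges : ∀ {u v} → Star R u v → List (Fin n × Fin n)
  edges     ε                   = []
  edges {u} (_◅_ {j = v} _ p) = (u , v) ∷ edges p

module _ {n W : ℕ} (G : Digraph n W) where
  open Digraph G

  walkWeight : ∀ {u v} → Walk u v → ℕ
  walkWeight ε             = 0
  walkWeight ((w , _) ◅ p) = toℕ w + walkWeight p

  record Path (u v : Fin n) : Set where
    field
      walk   : Walk u v
      simple : Unique (vertices walk)

    weight : ℕ
    weight = walkWeight walk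

    pathEdges : List (Fin n × Fin n)
    pathEdges = edges walk

  IsShortest : ∀ {u v} → (Path u v → Set) → Path u v → Set
  IsShortest Q p = Q p × (∀ q → Q q → Path.weight p ≤ Path.weight q)

  Connected : Set
  Connected = ∀ u v → Star Link u v

  UndirectedDiameter : ℕ → Set
  UndirectedDiameter D =
    (∀ u v → Σ (Star Link u v) λ p → length p ≤ D) ×
    (∃ λ u → ∃ λ v → (p : Star Link u v) → D ≤ length p)

record Instance (n W : ℕ) : Set where
  field
    graph         : Digraph n W
    source target : Fin n
    Pₛₜ           : Path graph source target

  open Path Pₛₜ public using () renaming (pathEdges to Pₛₜ-edges)

  field
    shortest : ∀ (q : Path graph source target) →
               Path.weight Pₛₜ ≤ Path.weight q

-- What a vertex v sees at the start, besides n and W.  Both directions of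
-- incident edges are visible, and s, t and P_st are known everywhere; protocols
-- that need only part of this information are thereby included.
record LocalInput (n W : ℕ) : Set where
  constructor localInput
  field
    self          : Fin n
    outgoing      : Vec (Maybe (Fin (suc W))) n
    incoming      : Vec (Maybe (Fin (suc W))) n
    source target : Fin n
    route         : List (Fin n)

localView : ∀ {n W} → Instance n W → Fin n → LocalInput n W
localView I v = localInput v (tabulate (entry v)) (tabulate λ u → entry u v)
                  source target (vertices (Path.walk Pₛₜ))
  where
  open Instance I
  open Digraph graph

-- The empty bit string stands for sending nothing.
Message : ℕ → Set
Message L = Vec≤ Bool L

-- Synchronous protocols on n-vertex networks, with messages of at most L bits.
-- Every vertex privately draws an independent uniform element of
-- Fin randomness; randomness = 1 gives the deterministic protocols.
record Protocol (Output : Set) (n W L : ℕ) : Set₁ where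
  field
    State      : Set
    rounds     : ℕ
    randomness : ℕ
    .{{randomness≢0}} : NonZero randomness
    init       : LocalInput n W → Fin randomness → State
    send       : State → Fin n → Message L
    receive    : State → Vec (Maybe (Message L)) n → State
    output     : State → Output

module _ {Output : Set} {n W L : ℕ} (A : Protocol Output n W L)
         (I : Instance n W) where
  open Protocol A
  open Instance I
  open Digraph graph

  statesAfter : ℕ → (Fin n → Fin randomness) → Vec State n
  statesAfter zero    ω = tabulate λ v → init (localView I v) (ω v)
  statesAfter (suc r) ω = tabulate λ v → receive (lookup σ v) (tabulate λ u →
      if linked u v then just (send (lookup σ u) v) else nothing)
    where
    σ : Vec State n
    σ = statesAfter r ω

  outputs : (Fin n → Fin randomness) → Fin n → Output
  outputs ω v = output (lookup (statesAfter rounds ω) v)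

  -- finToFun enumerates the randomness ^ n equally likely joint draws.
  SucceedsWithProb≥⅔ : ((Fin n → Output) → Set) → Set
  SucceedsWithProb≥⅔ Correct = Σ (Subset (randomness ^ n)) λ good →
    (2 * randomness ^ n ≤ 3 * ∣ good ∣) ×
    (∀ i → i ∈ₛ good → Correct (outputs (finToFun i)))

data ℕ∞ : Set where
  fin : ℕ → ℕ∞
  ∞   : ℕ∞

-- A vertex may abstain from announcing a weight or a successor.
record Answer (n : ℕ) : Set where
  field
    announced : Maybe ℕ∞
    successor : Maybe (Fin n)

module _ {n : ℕ} (ans : Fin n → Answer n) where
  open Answer

  -- Some vertex announces x.  Without the second clause, vertices could
  -- announce different guesses in the hope that one of them is right.
  Computes : ℕ∞ → Set
  Computes x = (∃ λ v → announced (ans v) ≡ just x) ×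
               (∀ v y → announced (ans v) ≡ just y → y ≡ x)

  FindsShortest : ∀ {W} (G : Digraph n W) {s t : Fin n} → (Path G s t → Set) → Set
  FindsShortest G Q =
    (∃ λ p → IsShortest G Q p × Computes (fin (Path.weight p)) ×
             (∀ u v → (u , v) ∈ Path.pathEdges p → successor (ans u) ≡ just v))
    ⊎ ((∀ p → ¬ Q p) × Computes ∞)

record Problem : Set₁ where
  field
    Output  : ℕ → Set
    Correct : ∀ {n W} → Instance n W → (Fin n → Output n) → Set

RPaths : Problem
RPaths = record
  { Output  = λ n → Fin n × Fin n → Answer n
  ; Correct = λ I out → let open Instance I in
      ∀ e → e ∈ Pₛₜ-edges →
      FindsShortest (λ v → out v e) graph {source} {target}
        (λ p → e ∉ Path.pathEdges p)
  }

2-SiSP : Problem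
2-SiSP = record
  { Output  = Answer
  ; Correct = λ I out → let open Instance I in
      FindsShortest out graph {source} {target}
        (λ p → ∃ λ e → e ∈ Pₛₜ-edges × e ∉ Path.pathEdges p)
  }

GraphClass : Set₁
GraphClass = ∀ {n W} → Digraph n W → Set

-- One protocol for each n, with weights up to W n and messages of up to L n bits.
Algorithm : Problem → (W L : ℕ → ℕ) → Set₁
Algorithm Π W L = ∀ n → Protocol (Problem.Output Π n) n (W n) (L n)

Solves : ∀ (Π : Problem) {W L} → Algorithm Π W L → GraphClass → Set
Solves Π {W} A 𝒞 = ∀ n (I : Instance n (W n)) → 𝒞 (Instance.graph I) →
  SucceedsWithProb≥⅔ (A n) I (Problem.Correct Π I)

-- Ω(n / log n) rounds on the graphs in 𝒞, for messages of at most b · ⌈log₂ n⌉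
-- bits and weights in {0,…,nᵃ}, for every b and all sufficiently large a.
-- The constants C and N do not depend on the algorithm.
RequiresΩ[n/logn] : Problem → GraphClass → Set₁
RequiresΩ[n/logn] Π 𝒞 =
  ∃ λ a₀ → ∀ a → a₀ ≤ a → ∀ b → ∃ λ C → ∃ λ N →
  (A : Algorithm Π (λ n → n ^ a) (λ n → b * ⌈log₂ n ⌉)) → Solves Π A 𝒞 →
  ∀ n → N ≤ n → n ≤ C * (Protocol.rounds (A n) * ⌈log₂ n ⌉)

{-# OPTIONS --safe #-}
module Submission where

-- Reduction from set disjointness on k² bits, k = Θ(n).  The path P_st is
-- p₀ q₀ p₁ q₁ … with weight 0; bit (i,j) of Alice is the arc p_i → v_j, of
-- weight k-1-i, bit (i,j) of Bob the arc v′_j → q_i, of weight i.  A simple path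
-- that omits an edge of P_st leaves it at some p_a and cannot return before q_a,
-- so it weighs at least k-1, with equality iff the two inputs intersect.  A sink
-- adjacent to every vertex makes the undirected diameter 2.  Only O(n) links join
-- Alice's and Bob's halves, so the messages across them take at most 2^(O(n R log n))
-- values in R rounds.
--
-- For the communication bound (after Razborov), split the coordinates at random
-- between the players, giving random bits to the owner of a coordinate and 0 to
-- the other player.  On a rectangle that is not exponentially small almost no
-- coordinate is heavily biased; forcing a random coordinate to be 1 on both sides
-- therefore keeps a constant fraction of the measure.  Hence a protocol that
-- recognises disjoint inputs with probability 2/3 also accepts intersecting ones
-- with probability above 1/3, unless it has 2^Ω(k²) transcripts.

open import Defs
open import Data.Bool using (Bool; true; false; not; _∧_; _∨_; if_then_else_; T)
open import Data.Bool.Properties using (∨-comm; ∨-zeroʳ) renaming (_≟_ to _≟ᵇ_)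
open import Data.Fin using (Fin; zero; suc; toℕ; fromℕ; fromℕ<; combine; remQuot; splitAt; _↑ˡ_; _↑ʳ_; opposite; inject≤; pred; finToFun; funToFin)
open import Data.Fin.Properties using (any?; all?; combine-injective; combine-surjective; finToFun-funToFin; opposite-prop; remQuot-combine; splitAt-↑ˡ; splitAt-↑ʳ; splitAt⁻¹-↑ˡ; splitAt⁻¹-↑ʳ; toℕ<n; toℕ-fromℕ; toℕ-fromℕ<; toℕ-inject₁; toℕ-inject≤; toℕ-injective; toℕ≤pred[n]) renaming (_≟_ to _≟ᶠ_)
open import Data.Fin.Subset using (Subset; ∣_∣) renaming (_∈_ to _∈ₛ_)
open import Data.List as List using (List; []; _∷_; _++_; map; allFin)
open import Data.List.Membership.Propositional using (_∈_; _∉_)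
open import Data.List.Properties using (∷-injective; length-++; length-map; length-tabulate; map-++; map-tabulate; map-∘)
open import Data.List.Relation.Unary.All as All using (All; []; _∷_)
open import Data.List.Relation.Unary.AllPairs using ([]; _∷_)
open import Data.List.Relation.Unary.Any using (here; there)
open import Data.List.Relation.Unary.Unique.Propositional using (Unique)
open import Data.Maybe as Maybe using (Maybe; just; nothing; is-just)
open import Data.Nat using (ℕ; zero; suc; _+_; _*_; _∸_; _^_; _/_; _%_; _≤_; _<_; _<?_; _≤?_; z≤n; s≤s; NonZero) renaming (_≟_ to _≟ⁿ_)
open import Data.Nat.DivMod using (m/n*n≤m; m≡m%n+[m/n]*n; m%n<n)
open import Data.Nat.ListAction using (sum)
open import Data.Nat.ListAction.Properties using (sum-++)
open import Data.Nat.Logarithm using (⌈log₂_⌉)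
open import Data.Nat.Properties
open import Data.Nat.Tactic.RingSolver using (solve-∀)
open import Data.Product using (Σ; ∃; ∃₂; _×_; _,_; proj₁; proj₂)
open import Data.Sum using (_⊎_; inj₁; inj₂; [_,_]′)
open import Data.Unit using (⊤; tt)
open import Data.Vec using (Vec; []; _∷_; here; there; lookup; tabulate; toList; zipWith; _[_]≔_) renaming (map to mapᵛ)
open import Data.Vec.Bounded as Vec≤ using (Vec≤)
open import Data.Vec.Properties using (lookup∘tabulate; lookup∘update; map-[]≔; tabulate-cong)
open import Function using (_∘_)
open import Relation.Binary.Construct.Closure.ReflexiveTransitive using (Star; ε; _◅_)
open import Relation.Binary.PropositionalEquality
open import Relation.Nullary using (¬_; Dec; does; yes; no; contradiction)
open import Relation.Nullary.Decidable using (map′; _×-dec_; _⊎-dec_; _→-dec_; dec-true; dec-false)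
open import Relation.Unary using (Decidable)

private
  variable
    X Y : Set

+-interchange : ∀ a b c d → a + b + (c + d) ≡ a + c + (b + d)
+-interchange = solve-∀

∑ : List X → (X → ℕ) → ℕ
∑ xs f = sum (map f xs)

syntax ∑ xs (λ x → e) = ∑[ x ∈ xs ] e

∑-cong : ∀ (xs : List X) {f g : X → ℕ} → (∀ x → f x ≡ g x) → ∑ xs f ≡ ∑ xs g
∑-cong []       f≡g = refl
∑-cong (x ∷ xs) f≡g = cong₂ _+_ (f≡g x) (∑-cong xs f≡g)

∑-mono : ∀ (xs : List X) {f g : X → ℕ} → (∀ x → f x ≤ g x) → ∑ xs f ≤ ∑ xs g
∑-mono []       f≤g = z≤n
∑-mono (x ∷ xs) f≤g = +-mono-≤ (f≤g x) (∑-mono xs f≤g)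

∑-+ : ∀ (xs : List X) (f g : X → ℕ) → (∑[ x ∈ xs ] (f x + g x)) ≡ ∑ xs f + ∑ xs g
∑-+ []       f g = refl
∑-+ (x ∷ xs) f g = trans (cong (f x + g x +_) (∑-+ xs f g)) (+-interchange (f x) (g x) _ _)

∑-* : ∀ (xs : List X) c (f : X → ℕ) → (∑[ x ∈ xs ] (c * f x)) ≡ c * ∑ xs f
∑-* []       c f = sym (*-zeroʳ c)
∑-* (x ∷ xs) c f = trans (cong (c * f x +_) (∑-* xs c f)) (sym (*-distribˡ-+ c (f x) _))

∑-const : ∀ (xs : List X) c → (∑[ x ∈ xs ] c) ≡ List.length xs * c
∑-const []       c = refl
∑-const (x ∷ xs) c = cong (c +_) (∑-const xs c)

∑-zero : ∀ (xs : List X) → (∑[ x ∈ xs ] 0) ≡ 0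
∑-zero xs = trans (∑-const xs 0) (*-zeroʳ (List.length xs))

∑-swap : ∀ (xs : List X) (ys : List Y) (f : X → Y → ℕ) →
         (∑[ x ∈ xs ] ∑[ y ∈ ys ] f x y) ≡ (∑[ y ∈ ys ] ∑[ x ∈ xs ] f x y)
∑-swap []       ys f = sym (∑-zero ys)
∑-swap (x ∷ xs) ys f = trans (cong (∑ ys (f x) +_) (∑-swap xs ys f)) (sym (∑-+ ys (f x) _))

∑-++ : ∀ (xs ys : List X) (f : X → ℕ) → ∑ (xs ++ ys) f ≡ ∑ xs f + ∑ ys f
∑-++ xs ys f = trans (cong sum (map-++ f xs ys)) (sum-++ (map f xs) (map f ys))

∑-map : ∀ (g : X → Y) (xs : List X) (f : Y → ℕ) → ∑ (map g xs) f ≡ ∑ xs (f ∘ g)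
∑-map g xs f = cong sum (sym (map-∘ xs))

∑-allFin-suc : ∀ n (f : Fin (suc n) → ℕ) → ∑ (allFin (suc n)) f ≡ f zero + ∑ (allFin n) (f ∘ suc)
∑-allFin-suc n f = cong (λ xs → f zero + sum xs)
  (trans (map-tabulate suc f) (sym (map-tabulate (λ i → i) (f ∘ suc))))

cube : ∀ n → List (Vec Bool n)
cube zero    = [] ∷ []
cube (suc n) = map (false ∷_) (cube n) ++ map (true ∷_) (cube n)

∑-cube-suc : ∀ n (f : Vec Bool (suc n) → ℕ) →
             ∑ (cube (suc n)) f ≡ ∑ (cube n) (f ∘ (false ∷_)) + ∑ (cube n) (f ∘ (true ∷_))
∑-cube-suc n f = trans (∑-++ (map (false ∷_) (cube n)) _ f)
  (cong₂ _+_ (∑-map (false ∷_) (cube n) f) (∑-map (true ∷_) (cube n) f))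

length-cube : ∀ n → List.length (cube n) ≡ 2 ^ n
length-cube zero    = refl
length-cube (suc n) = trans (length-++ (map (false ∷_) (cube n)))
  (cong₂ _+_ (trans (length-map (false ∷_) (cube n)) (length-cube n))
             (trans (length-map (true ∷_) (cube n)) (trans (length-cube n) (sym (+-identityʳ _)))))

∑-update : ∀ {n} (i : Fin n) (φ : Vec Bool n → ℕ) →
           (∑[ b ∈ cube n ] φ (b [ i ]≔ false)) + (∑[ b ∈ cube n ] φ (b [ i ]≔ true)) ≡ 2 * ∑ (cube n) φ
∑-update {suc n} zero φ
  rewrite ∑-cube-suc n (λ b → φ (b [ zero ]≔ false)) | ∑-cube-suc n (λ b → φ (b [ zero ]≔ true))
        | ∑-cube-suc n φ = double (∑ (cube n) (φ ∘ (false ∷_))) (∑ (cube n) (φ ∘ (true ∷_)))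
  where
  double : ∀ a b → a + a + (b + b) ≡ 2 * (a + b)
  double = solve-∀
∑-update {suc n} (suc i) φ
  rewrite ∑-cube-suc n (λ b → φ (b [ suc i ]≔ false)) | ∑-cube-suc n (λ b → φ (b [ suc i ]≔ true))
        | ∑-cube-suc n φ = begin
  a + b + (c + d)   ≡⟨ +-interchange a b c d ⟩
  a + c + (b + d)   ≡⟨ cong₂ _+_ (∑-update i (φ ∘ (false ∷_))) (∑-update i (φ ∘ (true ∷_))) ⟩
  2 * e + 2 * f     ≡⟨ *-distribˡ-+ 2 e f ⟨
  2 * (e + f)       ∎
  where
  open ≡-Reasoning
  a = ∑[ x ∈ cube n ] φ (false ∷ (x [ i ]≔ false))
  b = ∑[ x ∈ cube n ] φ (true  ∷ (x [ i ]≔ false))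
  c = ∑[ x ∈ cube n ] φ (false ∷ (x [ i ]≔ true))
  d = ∑[ x ∈ cube n ] φ (true  ∷ (x [ i ]≔ true))
  e = ∑ (cube n) (φ ∘ (false ∷_))
  f = ∑ (cube n) (φ ∘ (true ∷_))

-- Biased coordinates

tangent-above : ∀ d → (11 + d) * 10 ^ d ≤ 11 * 11 ^ d
tangent-above zero    = ≤-refl
tangent-above (suc d) = begin
  (11 + suc d) * (10 * 10 ^ d)                     ≤⟨ m≤m+n _ ((1 + d) * 10 ^ d) ⟩
  (11 + suc d) * (10 * 10 ^ d) + (1 + d) * 10 ^ d  ≡⟨ regroup d (10 ^ d) ⟩
  11 * ((11 + d) * 10 ^ d)                         ≤⟨ *-monoʳ-≤ 11 (tangent-above d) ⟩
  11 * (11 * 11 ^ d)                               ∎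
  where
  open ≤-Reasoning
  regroup : ∀ d x → (11 + suc d) * (10 * x) + (1 + d) * x ≡ 11 * ((11 + d) * x)
  regroup = solve-∀

tangent-below : ∀ d → 11 * 11 ^ d ≤ 11 * 10 ^ d + d * 11 ^ d
tangent-below zero    = ≤-refl
tangent-below (suc d) = begin
  11 * (11 * y)                         ≡⟨ split y ⟩
  10 * (11 * y) + 11 * y                ≤⟨ +-monoˡ-≤ (11 * y) (*-monoʳ-≤ 10 (tangent-below d)) ⟩
  10 * (11 * x + d * y) + 11 * y        ≤⟨ m≤m+n _ (d * y) ⟩
  10 * (11 * x + d * y) + 11 * y + d * y ≡⟨ regroup d x y ⟩
  11 * (10 * x) + suc d * (11 * y)      ∎
  where
  open ≤-Reasoning
  x = 10 ^ d
  y = 11 ^ d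
  split : ∀ y → 11 * (11 * y) ≡ 10 * (11 * y) + 11 * y
  split = solve-∀
  regroup : ∀ d x y → 10 * (11 * x + d * y) + 11 * y + d * y ≡ 11 * (10 * x) + suc d * (11 * y)
  regroup = solve-∀

-- The convex function p ↦ 11^p 10^(s-p) lies above (a rational lower bound
-- of) its tangent at p′.
tangent : ∀ p q p′ q′ → p + q ≡ p′ + q′ →
          (11 + p) * (11 ^ p′ * 10 ^ q′) ≤ 11 * (11 ^ p * 10 ^ q) + p′ * (11 ^ p′ * 10 ^ q′)
tangent p q p′ q′ eq with ≤-total p′ p
... | inj₁ p′≤p with d , refl ← m≤n⇒∃[o]m+o≡n p′≤p
                with refl ← +-cancelˡ-≡ p′ (d + q) q′ (trans (sym (+-assoc p′ d q)) eq) = begin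
  (11 + (p′ + d)) * (11 ^ p′ * 10 ^ (d + q))
    ≡⟨ cong (λ z → (11 + (p′ + d)) * (11 ^ p′ * z)) (^-distribˡ-+-* 10 d q) ⟩
  (11 + (p′ + d)) * (11 ^ p′ * (10 ^ d * 10 ^ q))
    ≡⟨ regroup p′ d (11 ^ p′) (10 ^ d) (10 ^ q) ⟩
  11 ^ p′ * 10 ^ q * ((11 + d) * 10 ^ d) + p′ * (11 ^ p′ * (10 ^ d * 10 ^ q))
    ≤⟨ +-monoˡ-≤ _ (*-monoʳ-≤ (11 ^ p′ * 10 ^ q) (tangent-above d)) ⟩
  11 ^ p′ * 10 ^ q * (11 * 11 ^ d) + p′ * (11 ^ p′ * (10 ^ d * 10 ^ q))
    ≡⟨ cong (_+ p′ * (11 ^ p′ * (10 ^ d * 10 ^ q))) (assoc (11 ^ p′) (10 ^ q) (11 ^ d)) ⟩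
  11 * (11 ^ p′ * 11 ^ d * 10 ^ q) + p′ * (11 ^ p′ * (10 ^ d * 10 ^ q))
    ≡⟨ cong₂ (λ y z → 11 * (y * 10 ^ q) + p′ * (11 ^ p′ * z)) (^-distribˡ-+-* 11 p′ d) (^-distribˡ-+-* 10 d q) ⟨
  11 * (11 ^ (p′ + d) * 10 ^ q) + p′ * (11 ^ p′ * 10 ^ (d + q)) ∎
  where
  open ≤-Reasoning
  regroup : ∀ p d x y z → (11 + (p + d)) * (x * (y * z)) ≡ x * z * ((11 + d) * y) + p * (x * (y * z))
  regroup = solve-∀
  assoc : ∀ x y z → x * y * (11 * z) ≡ 11 * (x * z * y)
  assoc = solve-∀
... | inj₂ p≤p′ with d , refl ← m≤n⇒∃[o]m+o≡n p≤p′
                with refl ← +-cancelˡ-≡ p q (d + q′) (trans eq (+-assoc p d q′)) = begin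
  (11 + p) * (11 ^ (p + d) * 10 ^ q′)
    ≡⟨ cong (λ z → (11 + p) * (z * 10 ^ q′)) (^-distribˡ-+-* 11 p d) ⟩
  (11 + p) * (11 ^ p * 11 ^ d * 10 ^ q′)
    ≡⟨ regroup p (11 ^ p) (11 ^ d) (10 ^ q′) ⟩
  11 ^ p * 10 ^ q′ * (11 * 11 ^ d) + p * (11 ^ p * 11 ^ d * 10 ^ q′)
    ≤⟨ +-monoˡ-≤ _ (*-monoʳ-≤ (11 ^ p * 10 ^ q′) (tangent-below d)) ⟩
  11 ^ p * 10 ^ q′ * (11 * 10 ^ d + d * 11 ^ d) + p * (11 ^ p * 11 ^ d * 10 ^ q′)
    ≡⟨ regroup′ p d (11 ^ p) (11 ^ d) (10 ^ d) (10 ^ q′) ⟩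
  11 * (11 ^ p * (10 ^ d * 10 ^ q′)) + (p + d) * (11 ^ p * 11 ^ d * 10 ^ q′)
    ≡⟨ cong₂ (λ y z → 11 * (11 ^ p * z) + (p + d) * (y * 10 ^ q′)) (^-distribˡ-+-* 11 p d) (^-distribˡ-+-* 10 d q′) ⟨
  11 * (11 ^ p * 10 ^ (d + q′)) + (p + d) * (11 ^ (p + d) * 10 ^ q′) ∎
  where
  open ≤-Reasoning
  regroup : ∀ p x y z → (11 + p) * (x * y * z) ≡ x * z * (11 * y) + p * (x * y * z)
  regroup = solve-∀
  regroup′ : ∀ p d x y w z → x * z * (11 * w + d * y) + p * (x * y * z)
                           ≡ 11 * (x * (w * z)) + (p + d) * (x * y * z)
  regroup′ = solve-∀

-- tilt P Q tells which of the masses P (of bit 0) and Q (of bit 1) exceeds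
-- three fifths of the total.
tilt : ℕ → ℕ → Maybe Bool
tilt P Q with 3 * Q <? 2 * P | 3 * P <? 2 * Q
... | yes _ | _     = just false
... | no _  | yes _ = just true
... | no _  | no _  = nothing

tilted : Maybe Bool → ℕ
tilted (just _) = 1
tilted nothing  = 0

agree clash : Maybe Bool → Bool → ℕ
agree (just true)  b = if b then 1 else 0
agree (just false) b = if b then 0 else 1
agree nothing      b = 0
clash t b = agree t (not b)

agree+clash : ∀ t b → agree t b + clash t b ≡ tilted t
agree+clash (just true)  true  = refl
agree+clash (just true)  false = refl
agree+clash (just false) true  = refl
agree+clash (just false) false = refl
agree+clash nothing      b     = refl

tilt-heavy : ∀ P Q → 3 * (tilted (tilt P Q) * (P + Q)) ≤ 5 * (P * agree (tilt P Q) false + Q * agree (tilt P Q) true)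
tilt-heavy P Q with 3 * Q <? 2 * P | 3 * P <? 2 * Q
... | yes 3Q<2P | _ = begin
  3 * (1 * (P + Q))       ≡⟨ a P Q ⟩
  3 * P + 3 * Q           ≤⟨ +-monoʳ-≤ (3 * P) (<⇒≤ 3Q<2P) ⟩
  3 * P + 2 * P           ≡⟨ b P Q ⟩
  5 * (P * 1 + Q * 0)     ∎
  where
  open ≤-Reasoning
  a : ∀ P Q → 3 * (1 * (P + Q)) ≡ 3 * P + 3 * Q
  a = solve-∀
  b : ∀ P Q → 3 * P + 2 * P ≡ 5 * (P * 1 + Q * 0)
  b = solve-∀
... | no _ | yes 3P<2Q = begin
  3 * (1 * (P + Q))       ≡⟨ a P Q ⟩
  3 * P + 3 * Q           ≤⟨ +-monoˡ-≤ (3 * Q) (<⇒≤ 3P<2Q) ⟩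
  2 * Q + 3 * Q           ≡⟨ b P Q ⟩
  5 * (P * 0 + Q * 1)     ∎
  where
  open ≤-Reasoning
  a : ∀ P Q → 3 * (1 * (P + Q)) ≡ 3 * P + 3 * Q
  a = solve-∀
  b : ∀ P Q → 2 * Q + 3 * Q ≡ 5 * (P * 0 + Q * 1)
  b = solve-∀
... | no _ | no _ = z≤n

module _ {n : ℕ} (dir : Fin n → Maybe Bool) where

  agrees clashes : Vec Bool n → ℕ
  agrees  b = ∑[ i ∈ allFin n ] agree (dir i) (lookup b i)
  clashes b = ∑[ i ∈ allFin n ] clash (dir i) (lookup b i)

  tilts : ℕ
  tilts = ∑[ i ∈ allFin n ] tilted (dir i)

  agrees+clashes : ∀ b → agrees b + clashes b ≡ tilts
  agrees+clashes b = trans (sym (∑-+ (allFin n) _ _))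
    (∑-cong (allFin n) λ i → agree+clash (dir i) (lookup b i))

∑-product-weight : ∀ α β {n} (dir : Fin n → Maybe Bool) →
  (∑[ b ∈ cube n ] (α ^ agrees dir b * β ^ clashes dir b)) * 2 ^ tilts dir ≡ 2 ^ n * (α + β) ^ tilts dir
∑-product-weight α β {zero}  dir = refl
∑-product-weight α β {suc n} dir
  rewrite ∑-cube-suc n (λ b → α ^ agrees dir b * β ^ clashes dir b)
        | ∑-allFin-suc n (λ i → tilted (dir i)) = begin
  (∑ (cube n) (weight′ false) + ∑ (cube n) (weight′ true)) * 2 ^ (tilted (dir zero) + m)
    ≡⟨ cong₂ (λ x y → (x + y) * 2 ^ (tilted (dir zero) + m)) (head false) (head true) ⟩
  (w false * S + w true * S) * 2 ^ (tilted (dir zero) + m)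
    ≡⟨ cong ((w false * S + w true * S) *_) (^-distribˡ-+-* 2 (tilted (dir zero)) m) ⟩
  (w false * S + w true * S) * (2 ^ tilted (dir zero) * 2 ^ m)
    ≡⟨ regroup (w false) (w true) S (2 ^ tilted (dir zero)) (2 ^ m) ⟩
  (w false + w true) * 2 ^ tilted (dir zero) * (S * 2 ^ m)
    ≡⟨ cong₂ _*_ (one (dir zero)) (∑-product-weight α β dir′) ⟩
  2 * (α + β) ^ tilted (dir zero) * (2 ^ n * (α + β) ^ m)
    ≡⟨ regroup′ ((α + β) ^ tilted (dir zero)) (2 ^ n) ((α + β) ^ m) ⟩
  2 * 2 ^ n * ((α + β) ^ tilted (dir zero) * (α + β) ^ m)
    ≡⟨ cong (2 * 2 ^ n *_) (^-distribˡ-+-* (α + β) (tilted (dir zero)) m) ⟨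
  2 * 2 ^ n * (α + β) ^ (tilted (dir zero) + m) ∎
  where
  open ≡-Reasoning
  dir′ = dir ∘ suc
  m = ∑ (allFin n) (λ i → tilted (dir (suc i)))
  S = ∑[ b ∈ cube n ] (α ^ agrees dir′ b * β ^ clashes dir′ b)
  w : Bool → ℕ
  w c = α ^ agree (dir zero) c * β ^ clash (dir zero) c
  weight′ : Bool → Vec Bool n → ℕ
  weight′ c b = α ^ agrees dir (c ∷ b) * β ^ clashes dir (c ∷ b)
  swap : ∀ a b c d → a * b * (c * d) ≡ a * c * (b * d)
  swap = solve-∀
  head : ∀ c → ∑ (cube n) (weight′ c) ≡ w c * S
  head c = trans (∑-cong (cube n) λ b → begin
      α ^ agrees dir (c ∷ b) * β ^ clashes dir (c ∷ b)
        ≡⟨ cong₂ (λ x y → α ^ x * β ^ y)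
             (∑-allFin-suc n (λ i → agree (dir i) (lookup (c ∷ b) i)))
             (∑-allFin-suc n (λ i → clash (dir i) (lookup (c ∷ b) i))) ⟩
      α ^ (agree (dir zero) c + agrees dir′ b) * β ^ (clash (dir zero) c + clashes dir′ b)
        ≡⟨ cong₂ _*_ (^-distribˡ-+-* α (agree (dir zero) c) _) (^-distribˡ-+-* β (clash (dir zero) c) _) ⟩
      α ^ agree (dir zero) c * α ^ agrees dir′ b * (β ^ clash (dir zero) c * β ^ clashes dir′ b)
        ≡⟨ swap (α ^ agree (dir zero) c) _ (β ^ clash (dir zero) c) _ ⟩
      w c * (α ^ agrees dir′ b * β ^ clashes dir′ b) ∎)
    (∑-* (cube n) (w c) _)
  regroup : ∀ a b s c d → (a * s + b * s) * (c * d) ≡ (a + b) * c * (s * d)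
  regroup = solve-∀
  regroup′ : ∀ a b c → 2 * a * (b * c) ≡ 2 * b * (a * c)
  regroup′ = solve-∀
  one : ∀ t → (α ^ agree t false * β ^ clash t false + α ^ agree t true * β ^ clash t true) * 2 ^ tilted t
              ≡ 2 * (α + β) ^ tilted t
  one (just true)  = e α β
    where e : ∀ α β → (1 * (β * 1) + α * 1 * 1) * 2 ≡ 2 * ((α + β) * 1)
          e = solve-∀
  one (just false) = e α β
    where e : ∀ α β → (α * 1 * 1 + 1 * (β * 1)) * 2 ≡ 2 * ((α + β) * 1)
          e = solve-∀
  one nothing      = refl

^-distribʳ-* : ∀ o m n → (m * n) ^ o ≡ m ^ o * n ^ o
^-distribʳ-* zero    m n = refl
^-distribʳ-* (suc o) m n = trans (cong (m * n *_) (^-distribʳ-* o m n)) (swap m n _ _)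
  where
  swap : ∀ a b c d → a * b * (c * d) ≡ a * c * (b * d)
  swap = solve-∀

geometric-decay : ∀ a c n m q H → .{{_ : NonZero a}} → a ≤ c → 2 * a ^ 36 ≤ c ^ 36 → 36 * q ≤ m →
                  H * c ^ m ≤ 2 ^ n * a ^ m → H * 2 ^ q ≤ 2 ^ n
geometric-decay a c n m q H a≤c 2a≤c 36q≤m bound
  with e , refl ← m≤n⇒∃[o]m+o≡n 36q≤m =
  *-cancelʳ-≤ (H * 2 ^ q) (2 ^ n) (a ^ (36 * q + e)) {{m^n≢0 a (36 * q + e)}} (begin
    H * 2 ^ q * a ^ (36 * q + e)               ≡⟨ *-assoc H (2 ^ q) _ ⟩
    H * (2 ^ q * a ^ (36 * q + e))             ≤⟨ *-monoʳ-≤ H power ⟩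
    H * c ^ (36 * q + e)                       ≤⟨ bound ⟩
    2 ^ n * a ^ (36 * q + e)                   ∎)
  where
  open ≤-Reasoning
  power : 2 ^ q * a ^ (36 * q + e) ≤ c ^ (36 * q + e)
  power = begin
    2 ^ q * a ^ (36 * q + e)         ≡⟨ cong (2 ^ q *_) (^-distribˡ-+-* a (36 * q) e) ⟩
    2 ^ q * (a ^ (36 * q) * a ^ e)   ≡⟨ *-assoc (2 ^ q) _ _ ⟨
    2 ^ q * a ^ (36 * q) * a ^ e     ≡⟨ cong (λ x → 2 ^ q * x * a ^ e) (^-*-assoc a 36 q) ⟨
    2 ^ q * (a ^ 36) ^ q * a ^ e     ≡⟨ cong (_* a ^ e) (^-distribʳ-* q 2 (a ^ 36)) ⟨
    (2 * a ^ 36) ^ q * a ^ e         ≤⟨ *-mono-≤ (^-monoˡ-≤ q 2a≤c) (^-monoˡ-≤ e a≤c) ⟩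
    (c ^ 36) ^ q * c ^ e             ≡⟨ cong (_* c ^ e) (^-*-assoc c 36 q) ⟩
    c ^ (36 * q) * c ^ e             ≡⟨ ^-distribˡ-+-* c (36 * q) e ⟨
    c ^ (36 * q + e)                 ∎

module _ {n : ℕ} (h : Vec Bool n → ℕ) where

  half : Fin n → Bool → ℕ
  half i α = ∑[ b ∈ cube n ] h (b [ i ]≔ α)

  dir : Fin n → Maybe Bool
  dir i = tilt (half i false) (half i true)

  agree-mass : ∀ i → 3 * (tilted (dir i) * ∑ (cube n) h) ≤
                     5 * (∑[ b ∈ cube n ] (h b * agree (dir i) (lookup b i)))
  agree-mass i = halve (tilted (dir i) * ∑ (cube n) h) (∑ (cube n) φ) (begin
    2 * (3 * (tilted (dir i) * ∑ (cube n) h))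
      ≡⟨ regroup (tilted (dir i)) _ ⟩
    3 * (tilted (dir i) * (2 * ∑ (cube n) h))
      ≡⟨ cong (λ x → 3 * (tilted (dir i) * x)) (∑-update i h) ⟨
    3 * (tilted (dir i) * (half i false + half i true))
      ≤⟨ tilt-heavy (half i false) (half i true) ⟩
    5 * (half i false * agree (dir i) false + half i true * agree (dir i) true)
      ≡⟨ cong₂ (λ x y → 5 * (x + y)) (fixed false) (fixed true) ⟨
    5 * ((∑[ b ∈ cube n ] φ (b [ i ]≔ false)) + (∑[ b ∈ cube n ] φ (b [ i ]≔ true)))
      ≡⟨ cong (5 *_) (∑-update i φ) ⟩
    5 * (2 * ∑ (cube n) φ) ∎)
    where
    open ≤-Reasoning
    φ : Vec Bool n → ℕ
    φ b = h b * agree (dir i) (lookup b i)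
    regroup : ∀ t x → 2 * (3 * (t * x)) ≡ 3 * (t * (2 * x))
    regroup = solve-∀
    fixed : ∀ α → (∑[ b ∈ cube n ] φ (b [ i ]≔ α)) ≡ half i α * agree (dir i) α
    fixed α = trans
      (∑-cong (cube n) λ b → trans
        (cong (λ x → h (b [ i ]≔ α) * agree (dir i) x) (lookup∘update i b α))
        (*-comm _ (agree (dir i) α)))
      (trans (∑-* (cube n) (agree (dir i) α) _) (*-comm (agree (dir i) α) _))
    halve : ∀ a b → 2 * (3 * a) ≤ 5 * (2 * b) → 3 * a ≤ 5 * b
    halve a b le = *-cancelˡ-≤ 2 (≤-trans le (≤-reflexive (commute b)))
      where
      commute : ∀ b → 5 * (2 * b) ≡ 2 * (5 * b)
      commute = solve-∀

  agrees-mass : 3 * (tilts dir * ∑ (cube n) h) ≤ 5 * (∑[ b ∈ cube n ] (h b * agrees dir b))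
  agrees-mass = begin
    3 * (tilts dir * H)                                  ≡⟨ cong (3 *_) (*-comm (tilts dir) H) ⟩
    3 * (H * tilts dir)                                  ≡⟨ cong (3 *_) (∑-* (allFin n) H _) ⟨
    3 * (∑[ i ∈ allFin n ] (H * tilted (dir i)))         ≡⟨ ∑-* (allFin n) 3 _ ⟨
    (∑[ i ∈ allFin n ] (3 * (H * tilted (dir i))))
      ≤⟨ ∑-mono (allFin n) (λ i → ≤-trans (≤-reflexive (cong (3 *_) (*-comm H _))) (agree-mass i)) ⟩
    (∑[ i ∈ allFin n ] (5 * (∑[ b ∈ cube n ] (h b * agree (dir i) (lookup b i)))))
      ≡⟨ ∑-* (allFin n) 5 _ ⟩
    5 * (∑[ i ∈ allFin n ] ∑[ b ∈ cube n ] (h b * agree (dir i) (lookup b i)))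
      ≡⟨ cong (5 *_) (∑-swap (allFin n) (cube n) _) ⟩
    5 * (∑[ b ∈ cube n ] ∑[ i ∈ allFin n ] (h b * agree (dir i) (lookup b i)))
      ≡⟨ cong (5 *_) (∑-cong (cube n) λ b → ∑-* (allFin n) (h b) _) ⟩
    5 * (∑[ b ∈ cube n ] (h b * agrees dir b)) ∎
    where
    open ≤-Reasoning
    H = ∑ (cube n) h

  -- Weight 11⁵ on the heavier value of each tilted bit and 10⁵ on the other one: the
  -- average weight (11⁵ + 10⁵) / 2 is less than (11⁵)^(3/5) (10⁵)^(2/5) = 11³ 10².
  tilted-mass : (∀ b → h b ≤ 1) →
    ∑ (cube n) h * ((11 ^ 3 * 10 ^ 2) * 2) ^ tilts dir ≤ 2 ^ n * (11 ^ 5 + 10 ^ 5) ^ tilts dir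
  tilted-mass h≤1 = begin
    H * ((11 ^ 3 * 10 ^ 2) * 2) ^ m                     ≡⟨ cong (H *_) powers ⟩
    H * (C * 2 ^ m)                                     ≡⟨ *-assoc H C (2 ^ m) ⟨
    H * C * 2 ^ m                                       ≤⟨ *-monoˡ-≤ (2 ^ m) tilted-weight ⟩
    (∑[ b ∈ cube n ] w b) * 2 ^ m                       ≡⟨ ∑-product-weight (11 ^ 5) (10 ^ 5) dir ⟩
    2 ^ n * (11 ^ 5 + 10 ^ 5) ^ m                       ∎
    where
    open ≤-Reasoning
    H = ∑ (cube n) h
    m = tilts dir
    C = 11 ^ (3 * m) * 10 ^ (2 * m)
    w : Vec Bool n → ℕ
    w b = (11 ^ 5) ^ agrees dir b * (10 ^ 5) ^ clashes dir b
    powers : ((11 ^ 3 * 10 ^ 2) * 2) ^ m ≡ C * 2 ^ m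
    powers = begin-equality
      ((11 ^ 3 * 10 ^ 2) * 2) ^ m              ≡⟨ ^-distribʳ-* m (11 ^ 3 * 10 ^ 2) 2 ⟩
      (11 ^ 3 * 10 ^ 2) ^ m * 2 ^ m            ≡⟨ cong (_* 2 ^ m) (^-distribʳ-* m (11 ^ 3) (10 ^ 2)) ⟩
      (11 ^ 3) ^ m * (10 ^ 2) ^ m * 2 ^ m
        ≡⟨ cong₂ (λ x y → x * y * 2 ^ m) (^-*-assoc 11 3 m) (^-*-assoc 10 2 m) ⟩
      C * 2 ^ m                                ∎
    exponents : ∀ b → 5 * agrees dir b + 5 * clashes dir b ≡ 3 * m + 2 * m
    exponents b = trans (sym (*-distribˡ-+ 5 (agrees dir b) _))
      (trans (cong (5 *_) (agrees+clashes dir b)) (*-distribʳ-+ m 3 2))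
    pointwise : ∀ b → h b * ((11 + 5 * agrees dir b) * C) ≤ 11 * w b + 3 * m * (h b * C)
    pointwise b = begin
      h b * ((11 + 5 * agrees dir b) * C)
        ≤⟨ *-monoʳ-≤ (h b) (tangent (5 * agrees dir b) (5 * clashes dir b) (3 * m) (2 * m) (exponents b)) ⟩
      h b * (11 * (11 ^ (5 * agrees dir b) * 10 ^ (5 * clashes dir b)) + 3 * m * C)
        ≡⟨ cong₂ (λ x y → h b * (11 * (x * y) + 3 * m * C)) (^-*-assoc 11 5 (agrees dir b)) (^-*-assoc 10 5 (clashes dir b)) ⟨
      h b * (11 * w b + 3 * m * C)
        ≡⟨ e (h b) (w b) (3 * m) C ⟩
      h b * (11 * w b) + 3 * m * (h b * C)
        ≤⟨ +-monoˡ-≤ _ (*-monoˡ-≤ (11 * w b) (h≤1 b)) ⟩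
      1 * (11 * w b) + 3 * m * (h b * C)
        ≡⟨ cong (_+ 3 * m * (h b * C)) (*-identityˡ (11 * w b)) ⟩
      11 * w b + 3 * m * (h b * C) ∎
      where
      e : ∀ h w m c → h * (11 * w + m * c) ≡ h * (11 * w) + m * (h * c)
      e = solve-∀
    tilted-weight : H * C ≤ ∑ (cube n) w
    tilted-weight = *-cancelˡ-≤ 11 (+-cancelʳ-≤ (3 * m * (H * C)) _ _ (begin
      11 * (H * C) + 3 * m * (H * C)
        ≡⟨ e₁ m H C ⟩
      11 * (H * C) + 3 * (m * H) * C
        ≤⟨ +-monoʳ-≤ (11 * (H * C)) (*-monoˡ-≤ C agrees-mass) ⟩
      11 * (H * C) + 5 * A * C
        ≡⟨ e₂ H A C ⟩
      (11 * C) * H + (5 * C) * A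
        ≡⟨ cong₂ _+_ (∑-* (cube n) (11 * C) h) (∑-* (cube n) (5 * C) (λ b → h b * agrees dir b)) ⟨
      (∑[ b ∈ cube n ] (11 * C * h b)) + (∑[ b ∈ cube n ] (5 * C * (h b * agrees dir b)))
        ≡⟨ ∑-+ (cube n) _ _ ⟨
      (∑[ b ∈ cube n ] (11 * C * h b + 5 * C * (h b * agrees dir b)))
        ≤⟨ ∑-mono (cube n) (λ b → ≤-trans (≤-reflexive (e₃ (h b) (agrees dir b) C)) (pointwise b)) ⟩
      (∑[ b ∈ cube n ] (11 * w b + 3 * m * (h b * C)))
        ≡⟨ ∑-+ (cube n) _ _ ⟩
      (∑[ b ∈ cube n ] (11 * w b)) + (∑[ b ∈ cube n ] (3 * m * (h b * C)))
        ≡⟨ cong₂ _+_ (∑-* (cube n) 11 w) (trans (∑-* (cube n) (3 * m) _)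
             (cong (3 * m *_) (trans (∑-cong (cube n) λ b → *-comm (h b) C)
                              (trans (∑-* (cube n) C h) (*-comm C H))))) ⟩
      11 * ∑ (cube n) w + 3 * m * (H * C) ∎))
      where
      A = ∑[ b ∈ cube n ] (h b * agrees dir b)
      e₁ : ∀ m h c → 11 * (h * c) + 3 * m * (h * c) ≡ 11 * (h * c) + 3 * (m * h) * c
      e₁ = solve-∀
      e₂ : ∀ h a c → 11 * (h * c) + 5 * a * c ≡ (11 * c) * h + (5 * c) * a
      e₂ = solve-∀
      e₃ : ∀ h k c → 11 * c * h + 5 * c * (h * k) ≡ h * ((11 + 5 * k) * c)
      e₃ = solve-∀

  -- 2 (11⁵ + 10⁵)³⁶ ≤ (2 · 11³ · 10²)³⁶
  many-tilts : ∀ q → (∀ b → h b ≤ 1) → 36 * q ≤ tilts dir → ∑ (cube n) h * 2 ^ q ≤ 2 ^ n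
  many-tilts q h≤1 36q≤m =
    geometric-decay (11 ^ 5 + 10 ^ 5) ((11 ^ 3 * 10 ^ 2) * 2) n (tilts dir) q (∑ (cube n) h)
      (≤ᵇ⇒≤ _ _ tt) (≤ᵇ⇒≤ _ _ tt) 36q≤m (tilted-mass h≤1)

-- Corruption of rectangles

_⊙_ : ∀ {n} → Vec Bool n → Vec Bool n → Vec Bool n
_⊙_ = zipWith _∧_

∁ : ∀ {n} → Vec Bool n → Vec Bool n
∁ = mapᵛ not

⊙-[]≔ : ∀ {n} (D b : Vec Bool n) i d α → (D [ i ]≔ d) ⊙ (b [ i ]≔ α) ≡ (D ⊙ b) [ i ]≔ (d ∧ α)
⊙-[]≔ (x ∷ D) (y ∷ b) zero    d α = refl
⊙-[]≔ (x ∷ D) (y ∷ b) (suc i) d α = cong ((x ∧ y) ∷_) (⊙-[]≔ D b i d α)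

slice : ∀ {n} → Vec Bool n → (Vec Bool n → ℕ) → ℕ
slice []          f = f []
slice (true  ∷ D) f = slice D (f ∘ (false ∷_)) + slice D (f ∘ (true ∷_))
slice (false ∷ D) f = slice D (f ∘ (false ∷_))

slice-product : ∀ {n} (D : Vec Bool n) f g →
  (∑[ b ∈ cube n ] (f (D ⊙ b) * g (∁ D ⊙ b))) ≡ slice D f * slice (∁ D) g
slice-product {zero}  []          f g = +-identityʳ _
slice-product {suc n} (true ∷ D)  f g = begin
  (∑[ b ∈ cube (suc n) ] (f ((true ∷ D) ⊙ b) * g (∁ (true ∷ D) ⊙ b)))
    ≡⟨ ∑-cube-suc n _ ⟩
  (∑[ b ∈ cube n ] (f (false ∷ (D ⊙ b)) * g (false ∷ (∁ D ⊙ b)))) +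
  (∑[ b ∈ cube n ] (f (true  ∷ (D ⊙ b)) * g (false ∷ (∁ D ⊙ b))))
    ≡⟨ cong₂ _+_ (slice-product D (f ∘ (false ∷_)) (g ∘ (false ∷_))) (slice-product D (f ∘ (true ∷_)) (g ∘ (false ∷_))) ⟩
  slice D (f ∘ (false ∷_)) * slice (∁ D) (g ∘ (false ∷_)) + slice D (f ∘ (true ∷_)) * slice (∁ D) (g ∘ (false ∷_))
    ≡⟨ *-distribʳ-+ (slice (∁ D) (g ∘ (false ∷_))) (slice D (f ∘ (false ∷_))) _ ⟨
  slice (true ∷ D) f * slice (∁ (true ∷ D)) g ∎
  where open ≡-Reasoning
slice-product {suc n} (false ∷ D) f g = begin
  (∑[ b ∈ cube (suc n) ] (f ((false ∷ D) ⊙ b) * g (∁ (false ∷ D) ⊙ b)))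
    ≡⟨ ∑-cube-suc n _ ⟩
  (∑[ b ∈ cube n ] (f (false ∷ (D ⊙ b)) * g (false ∷ (∁ D ⊙ b)))) +
  (∑[ b ∈ cube n ] (f (false ∷ (D ⊙ b)) * g (true ∷ (∁ D ⊙ b))))
    ≡⟨ cong₂ _+_ (slice-product D (f ∘ (false ∷_)) (g ∘ (false ∷_))) (slice-product D (f ∘ (false ∷_)) (g ∘ (true ∷_))) ⟩
  slice D (f ∘ (false ∷_)) * slice (∁ D) (g ∘ (false ∷_)) + slice D (f ∘ (false ∷_)) * slice (∁ D) (g ∘ (true ∷_))
    ≡⟨ *-distribˡ-+ (slice D (f ∘ (false ∷_))) _ _ ⟨
  slice (false ∷ D) f * slice (∁ (false ∷ D)) g ∎
  where open ≡-Reasoning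

charge : ℕ → ℕ → ℕ
charge P Q = tilted (tilt P Q) * (P + Q)

tilt-charge : ∀ P Q → charge P Q ≡ P + Q ⊎ (charge P Q ≡ 0 × 2 * P ≤ 3 * Q × 2 * Q ≤ 3 * P)
tilt-charge P Q with 3 * Q <? 2 * P | 3 * P <? 2 * Q
... | yes _   | _       = inj₁ (*-identityˡ (P + Q))
... | no _    | yes _   = inj₁ (*-identityˡ (P + Q))
... | no 3Q≮2P | no 3P≮2Q = inj₂ (refl , ≮⇒≥ 3Q≮2P , ≮⇒≥ 3P≮2Q)

balanced-rank-one : ∀ P Q R Z → P * Z ≡ Q * R → 2 * P ≤ 3 * Q → 2 * Q ≤ 3 * P → 2 * P ≤ 3 * R → 2 * R ≤ 3 * P →
                    8 * (P + R + (P + Q)) ≤ 60 * Z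
balanced-rank-one zero zero zero Z _ _ _ _ _ = z≤n
balanced-rank-one zero (suc Q) R Z _ _ 2Q≤0 _ _ = contradiction 2Q≤0 λ ()
balanced-rank-one zero zero (suc R) Z _ _ _ _ 2R≤0 = contradiction 2R≤0 λ ()
balanced-rank-one P@(suc _) Q R Z PZ≡QR 2P≤3Q _ 2P≤3R _
  with s , 3Q≡ ← m≤n⇒∃[o]m+o≡n 2P≤3Q | t , 3R≡ ← m≤n⇒∃[o]m+o≡n 2P≤3R =
  *-cancelˡ-≤ P (*-cancelˡ-≤ 9 (begin
    9 * (P * (8 * (P + R + (P + Q))))                 ≡⟨ e₁ P Q R ⟩
    24 * (P * (6 * P + 3 * R + 3 * Q))                ≡⟨ cong₂ (λ r q → 24 * (P * (6 * P + r + q))) 3R≡ 3Q≡ ⟨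
    24 * (P * (6 * P + (2 * P + t) + (2 * P + s)))    ≤⟨ m≤m+n _ (36 * (P * (s + t)) + 60 * (s * t) + 60 * (P * (s + t))) ⟩
    24 * (P * (6 * P + (2 * P + t) + (2 * P + s))) + (36 * (P * (s + t)) + 60 * (s * t) + 60 * (P * (s + t)))
                                                      ≡⟨ e₂ P s t ⟩
    60 * ((2 * P + s) * (2 * P + t))                  ≡⟨ cong₂ (λ q r → 60 * (q * r)) 3Q≡ 3R≡ ⟩
    60 * (3 * Q * (3 * R))                            ≡⟨ e₃ Q R ⟩
    9 * (60 * (Q * R))                                ≡⟨ cong (λ x → 9 * (60 * x)) PZ≡QR ⟨
    9 * (60 * (P * Z))                                ≡⟨ e₄ P Z ⟩
    9 * (P * (60 * Z))                                ∎))
  where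
  open ≤-Reasoning
  e₁ : ∀ P Q R → 9 * (P * (8 * (P + R + (P + Q)))) ≡ 24 * (P * (6 * P + 3 * R + 3 * Q))
  e₁ = solve-∀
  e₂ : ∀ P s t → 24 * (P * (6 * P + (2 * P + t) + (2 * P + s))) + (36 * (P * (s + t)) + 60 * (s * t) + 60 * (P * (s + t)))
               ≡ 60 * ((2 * P + s) * (2 * P + t))
  e₂ = solve-∀
  e₃ : ∀ Q R → 60 * (3 * Q * (3 * R)) ≡ 9 * (60 * (Q * R))
  e₃ = solve-∀
  e₄ : ∀ P Z → 9 * (60 * (P * Z)) ≡ 9 * (P * (60 * Z))
  e₄ = solve-∀

one-sided : ∀ P Q R → 2 * R ≤ 3 * P → 8 * (P + R + (P + Q)) ≤ 32 * (P + Q)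
one-sided P Q R 2R≤3P = begin
  8 * (P + R + (P + Q))          ≡⟨ e₁ P Q R ⟩
  16 * P + 8 * Q + 4 * (2 * R)   ≤⟨ +-monoʳ-≤ (16 * P + 8 * Q) (*-monoʳ-≤ 4 2R≤3P) ⟩
  16 * P + 8 * Q + 4 * (3 * P)   ≤⟨ m≤m+n _ (4 * P + 24 * Q) ⟩
  16 * P + 8 * Q + 4 * (3 * P) + (4 * P + 24 * Q) ≡⟨ e₂ P Q ⟩
  32 * (P + Q)                   ∎
  where
  open ≤-Reasoning
  e₁ : ∀ P Q R → 8 * (P + R + (P + Q)) ≡ 16 * P + 8 * Q + 4 * (2 * R)
  e₁ = solve-∀
  e₂ : ∀ P Q → 16 * P + 8 * Q + 4 * (3 * P) + (4 * P + 24 * Q) ≡ 32 * (P + Q)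
  e₂ = solve-∀

rank-one-charge : ∀ P Q R Z → P * Z ≡ Q * R →
                  8 * (P + R + (P + Q)) ≤ 60 * Z + 32 * (charge P R + charge P Q)
rank-one-charge P Q R Z PZ≡QR with tilt-charge P Q | tilt-charge P R
... | inj₁ p≡ | inj₁ r≡ rewrite p≡ | r≡ =
  ≤-trans (*-monoˡ-≤ (P + R + (P + Q)) {8} {32} (≤ᵇ⇒≤ 8 32 tt)) (m≤n+m _ (60 * Z))
... | inj₁ p≡ | inj₂ (r≡ , _ , 2R≤3P) rewrite p≡ | r≡ =
  ≤-trans (one-sided P Q R 2R≤3P) (m≤n+m _ (60 * Z))
... | inj₂ (p≡ , _ , 2Q≤3P) | inj₁ r≡ rewrite p≡ | r≡ | +-identityʳ (P + R) =
  ≤-trans (≤-reflexive (cong (8 *_) (+-comm (P + R) (P + Q))))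
    (≤-trans (one-sided P R Q 2Q≤3P) (m≤n+m _ (60 * Z)))
... | inj₂ (_ , 2P≤3Q , 2Q≤3P) | inj₂ (_ , 2P≤3R , 2R≤3P) =
  ≤-trans (balanced-rank-one P Q R Z PZ≡QR 2P≤3Q 2Q≤3P 2P≤3R 2R≤3P) (m≤m+n (60 * Z) _)

-- D is the set of Alice's coordinates: h D sums to the mass of the rectangle
-- f × g on the disjoint pairs (D ⊙ b , ∁ D ⊙ b), and M₁ is its mass on these pairs
-- with one coordinate i set to 1 on both sides.
module Rectangle {n : ℕ} (f g : Vec Bool n → ℕ) where

  h : Vec Bool n → Vec Bool n → ℕ
  h D b = f (D ⊙ b) * g (∁ D ⊙ b)

  mass : Vec Bool n → Fin n → Bool → Bool → ℕ
  mass D i α β = ∑[ b ∈ cube n ] (f ((D ⊙ b) [ i ]≔ α) * g ((∁ D ⊙ b) [ i ]≔ β))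

  mass-rank-one : ∀ D i → mass D i false false * mass D i true true ≡ mass D i true false * mass D i false true
  mass-rank-one D i =
    trans (cong₂ _*_ (factor false false) (factor true true))
      (trans (swap (F false) (G false) (F true) (G true))
        (sym (cong₂ _*_ (factor true false) (factor false true))))
    where
    F G : Bool → ℕ
    F α = slice D (λ x → f (x [ i ]≔ α))
    G β = slice (∁ D) (λ y → g (y [ i ]≔ β))
    factor : ∀ α β → mass D i α β ≡ F α * G β
    factor α β = slice-product D _ _
    swap : ∀ a b c d → a * b * (c * d) ≡ c * b * (a * d)
    swap = solve-∀

  half-true : ∀ D i α → half (h (D [ i ]≔ true)) i α ≡ mass D i α false
  half-true D i α = ∑-cong (cube n) λ b → cong₂ (λ x y → f x * g y) (⊙-[]≔ D b i true α)
    (trans (cong (_⊙ (b [ i ]≔ α)) (map-[]≔ not D i)) (⊙-[]≔ (∁ D) b i false α))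

  half-false : ∀ D i α → half (h (D [ i ]≔ false)) i α ≡ mass D i false α
  half-false D i α = ∑-cong (cube n) λ b → cong₂ (λ x y → f x * g y) (⊙-[]≔ D b i false α)
    (trans (cong (_⊙ (b [ i ]≔ α)) (map-[]≔ not D i)) (⊙-[]≔ (∁ D) b i true α))

  M₀ M₁ B : ℕ
  M₀ = ∑[ D ∈ cube n ] ∑[ b ∈ cube n ] h D b
  M₁ = ∑[ i ∈ allFin n ] ∑[ D ∈ cube n ] mass D i true true
  B  = ∑[ D ∈ cube n ] (tilts (dir (h D)) * ∑ (cube n) (h D))

  pair-halves : ∀ i (ψ : ℕ → ℕ → ℕ) →
    2 * (∑[ D ∈ cube n ] ψ (half (h D) i false) (half (h D) i true)) ≡
    (∑[ D ∈ cube n ] (ψ (mass D i false false) (mass D i false true) + ψ (mass D i false false) (mass D i true false)))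
  pair-halves i ψ = trans (sym (∑-update i _)) (trans
    (cong₂ _+_ (∑-cong (cube n) λ D → cong₂ ψ (half-false D i false) (half-false D i true))
               (∑-cong (cube n) λ D → cong₂ ψ (half-true D i false) (half-true D i true)))
    (sym (∑-+ (cube n) _ _)))

  coordinate : ∀ i → 8 * M₀ ≤ 15 * (∑[ D ∈ cube n ] mass D i true true) +
                              32 * (∑[ D ∈ cube n ] (tilted (dir (h D) i) * ∑ (cube n) (h D)))
  coordinate i = *-cancelˡ-≤ 4 (begin
    4 * (8 * M₀)          ≡⟨ e₁ M₀ ⟩
    8 * (2 * (2 * M₀))    ≡⟨ cong (λ x → 8 * (2 * x)) (∑-* (cube n) 2 _) ⟨
    8 * (2 * (∑[ D ∈ cube n ] (2 * ∑ (cube n) (h D))))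
      ≡⟨ cong (λ x → 8 * (2 * x)) (∑-cong (cube n) λ D → sym (∑-update i (h D))) ⟩
    8 * (2 * (∑[ D ∈ cube n ] (half (h D) i false + half (h D) i true)))
      ≡⟨ cong (8 *_) (pair-halves i _+_) ⟩
    8 * (∑[ D ∈ cube n ] (mass D i false false + mass D i false true + (mass D i false false + mass D i true false)))
      ≡⟨ ∑-* (cube n) 8 _ ⟨
    (∑[ D ∈ cube n ] (8 * (mass D i false false + mass D i false true + (mass D i false false + mass D i true false))))
      ≤⟨ ∑-mono (cube n) (λ D → rank-one-charge (mass D i false false) (mass D i true false) (mass D i false true) (mass D i true true) (mass-rank-one D i)) ⟩
    (∑[ D ∈ cube n ] (60 * mass D i true true +
       32 * (charge (mass D i false false) (mass D i false true) + charge (mass D i false false) (mass D i true false))))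
      ≡⟨ ∑-+ (cube n) _ _ ⟩
    (∑[ D ∈ cube n ] (60 * mass D i true true)) +
    (∑[ D ∈ cube n ] (32 * (charge (mass D i false false) (mass D i false true) + charge (mass D i false false) (mass D i true false))))
      ≡⟨ cong₂ _+_ (∑-* (cube n) 60 _) (trans (∑-* (cube n) 32 _) (cong (32 *_) (sym (pair-halves i charge)))) ⟩
    60 * Z + 32 * (2 * (∑[ D ∈ cube n ] (tilted (dir (h D) i) * (half (h D) i false + half (h D) i true))))
      ≡⟨ cong (λ x → 60 * Z + 32 * (2 * x)) (trans
           (∑-cong (cube n) λ D → trans (cong (tilted (dir (h D) i) *_) (∑-update i (h D))) (e₃ (tilted (dir (h D) i)) _))
           (∑-* (cube n) 2 _)) ⟩
    60 * Z + 32 * (2 * (2 * C))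
      ≡⟨ e₂ Z C ⟩
    4 * (15 * Z + 32 * C) ∎)
    where
    open ≤-Reasoning
    Z = ∑[ D ∈ cube n ] mass D i true true
    C = ∑[ D ∈ cube n ] (tilted (dir (h D) i) * ∑ (cube n) (h D))
    e₁ : ∀ m → 4 * (8 * m) ≡ 8 * (2 * (2 * m))
    e₁ = solve-∀
    e₂ : ∀ z c → 60 * z + 32 * (2 * (2 * c)) ≡ 4 * (15 * z + 32 * c)
    e₂ = solve-∀
    e₃ : ∀ t x → t * (2 * x) ≡ 2 * (t * x)
    e₃ = solve-∀

  all-coordinates : 8 * (n * M₀) ≤ 15 * M₁ + 32 * B
  all-coordinates = begin
    8 * (n * M₀)          ≡⟨ e n M₀ ⟩
    n * (8 * M₀)          ≡⟨ cong (_* (8 * M₀)) (length-tabulate {n = n} (λ i → i)) ⟨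
    List.length (allFin n) * (8 * M₀) ≡⟨ ∑-const (allFin n) (8 * M₀) ⟨
    (∑[ i ∈ allFin n ] (8 * M₀)) ≤⟨ ∑-mono (allFin n) coordinate ⟩
    (∑[ i ∈ allFin n ] (15 * (∑[ D ∈ cube n ] mass D i true true) +
                        32 * (∑[ D ∈ cube n ] (tilted (dir (h D) i) * ∑ (cube n) (h D)))))
      ≡⟨ ∑-+ (allFin n) _ _ ⟩
    _ ≡⟨ cong₂ _+_ (∑-* (allFin n) 15 _) (trans (∑-* (allFin n) 32 _) (cong (32 *_) (trans
           (∑-swap (allFin n) (cube n) _)
           (∑-cong (cube n) λ D → trans (∑-cong (allFin n) λ i → *-comm (tilted (dir (h D) i)) _)
             (trans (∑-* (allFin n) (∑ (cube n) (h D)) _) (*-comm (∑ (cube n) (h D)) _)))))) ⟩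
    15 * M₁ + 32 * B ∎
    where
    open ≤-Reasoning
    e : ∀ n m → 8 * (n * m) ≡ n * (8 * m)
    e = solve-∀

  tilts≤n : ∀ D → tilts (dir (h D)) ≤ n
  tilts≤n D = begin
    tilts (dir (h D))           ≤⟨ ∑-mono (allFin n) (λ i → tilted≤1 (dir (h D) i)) ⟩
    (∑[ i ∈ allFin n ] 1)       ≡⟨ ∑-const (allFin n) 1 ⟩
    List.length (allFin n) * 1       ≡⟨ *-identityʳ _ ⟩
    List.length (allFin n)           ≡⟨ length-tabulate {n = n} (λ i → i) ⟩
    n                           ∎
    where
    open ≤-Reasoning
    tilted≤1 : ∀ t → tilted t ≤ 1
    tilted≤1 (just _) = ≤-refl
    tilted≤1 nothing  = z≤n

  module _ (f≤1 : ∀ x → f x ≤ 1) (g≤1 : ∀ y → g y ≤ 1) (c q : ℕ) (q-small : c * (36 * q) ≤ n) where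

    charge-bound : ∀ D → c * (2 ^ q * (tilts (dir (h D)) * ∑ (cube n) (h D))) ≤
                         2 ^ q * (n * ∑ (cube n) (h D)) + c * (n * 2 ^ n)
    charge-bound D with 36 * q ≤? tilts (dir (h D))
    ... | yes 36q≤m = begin
      c * (2 ^ q * (m * H))       ≡⟨ e c (2 ^ q) m H ⟩
      c * (m * (H * 2 ^ q))
        ≤⟨ *-monoʳ-≤ c (*-mono-≤ (tilts≤n D) (many-tilts (h D) q (λ b → *-mono-≤ (f≤1 _) (g≤1 _)) 36q≤m)) ⟩
      c * (n * 2 ^ n)             ≤⟨ m≤n+m _ (2 ^ q * (n * H)) ⟩
      2 ^ q * (n * H) + c * (n * 2 ^ n) ∎
      where
      open ≤-Reasoning
      m = tilts (dir (h D))
      H = ∑ (cube n) (h D)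
      e : ∀ c t m h → c * (t * (m * h)) ≡ c * (m * (h * t))
      e = solve-∀
    ... | no 36q≰m = begin
      c * (2 ^ q * (m * H))       ≡⟨ e c (2 ^ q) m H ⟩
      2 ^ q * (c * m * H)         ≤⟨ *-monoʳ-≤ (2 ^ q) (*-monoˡ-≤ H few) ⟩
      2 ^ q * (n * H)               ≤⟨ m≤m+n _ _ ⟩
      2 ^ q * (n * H) + c * (n * 2 ^ n) ∎
      where
      open ≤-Reasoning
      m = tilts (dir (h D))
      H = ∑ (cube n) (h D)
      e : ∀ c t m h → c * (t * (m * h)) ≡ t * (c * m * h)
      e = solve-∀
      few : c * m ≤ n
      few = begin
        c * m          ≤⟨ *-monoʳ-≤ c (<⇒≤ (≰⇒> 36q≰m)) ⟩
        c * (36 * q)   ≤⟨ q-small ⟩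
        n                ∎

    charge-total : c * (2 ^ q * B) ≤ 2 ^ q * (n * M₀) + c * (n * (2 ^ n * 2 ^ n))
    charge-total = begin
      c * (2 ^ q * B)  ≡⟨ trans (∑-* (cube n) c _) (cong (c *_) (∑-* (cube n) (2 ^ q) _)) ⟨
      (∑[ D ∈ cube n ] (c * (2 ^ q * (tilts (dir (h D)) * ∑ (cube n) (h D)))))
        ≤⟨ ∑-mono (cube n) charge-bound ⟩
      (∑[ D ∈ cube n ] (2 ^ q * (n * ∑ (cube n) (h D)) + c * (n * 2 ^ n)))
        ≡⟨ ∑-+ (cube n) _ _ ⟩
      (∑[ D ∈ cube n ] (2 ^ q * (n * ∑ (cube n) (h D)))) + (∑[ D ∈ cube n ] (c * (n * 2 ^ n)))
        ≡⟨ cong₂ _+_ (trans (∑-* (cube n) (2 ^ q) _) (cong (2 ^ q *_) (∑-* (cube n) n _)))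
             (trans (∑-const (cube n) _) (trans (cong (_* (c * (n * 2 ^ n))) (length-cube n)) (e c (2 ^ n) n))) ⟩
      2 ^ q * (n * M₀) + c * (n * (2 ^ n * 2 ^ n)) ∎
      where
      open ≤-Reasoning
      e : ∀ c t n → t * (c * (n * t)) ≡ c * (n * (t * t))
      e = solve-∀

  corruption : (∀ x → f x ≤ 1) → (∀ y → g y ≤ 1) → ∀ q → 128 * (36 * q) ≤ n →
             31 * (2 ^ q * (n * M₀)) ≤ 60 * (2 ^ q * M₁) + 128 * (n * (2 ^ n * 2 ^ n))
  corruption f≤1 g≤1 q q-small = +-cancelʳ-≤ (2 ^ q * (n * M₀)) _ _ (begin
    31 * (2 ^ q * (n * M₀)) + 2 ^ q * (n * M₀)   ≡⟨ e₁ (2 ^ q) (n * M₀) ⟩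
    4 * (2 ^ q * (8 * (n * M₀)))                 ≤⟨ *-monoʳ-≤ 4 (*-monoʳ-≤ (2 ^ q) all-coordinates) ⟩
    4 * (2 ^ q * (15 * M₁ + 32 * B))             ≡⟨ e₂ (2 ^ q) M₁ B ⟩
    60 * (2 ^ q * M₁) + 128 * (2 ^ q * B)        ≤⟨ +-monoʳ-≤ (60 * (2 ^ q * M₁)) (charge-total f≤1 g≤1 128 q q-small) ⟩
    60 * (2 ^ q * M₁) + (2 ^ q * (n * M₀) + 128 * (n * (2 ^ n * 2 ^ n)))
                                                 ≡⟨ e₃ (60 * (2 ^ q * M₁)) (2 ^ q * (n * M₀)) _ ⟩
    60 * (2 ^ q * M₁) + 128 * (n * (2 ^ n * 2 ^ n)) + 2 ^ q * (n * M₀) ∎)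
    where
    open ≤-Reasoning
    e₁ : ∀ t m → 31 * (t * m) + t * m ≡ 4 * (t * (8 * m))
    e₁ = solve-∀
    e₂ : ∀ t m b → 4 * (t * (15 * m + 32 * b)) ≡ 60 * (t * m) + 128 * (t * b)
    e₂ = solve-∀
    e₃ : ∀ a b c → a + (b + c) ≡ a + c + b
    e₃ = solve-∀

∑-rotate : ∀ {A B C : Set} (xs : List A) (ys : List B) (zs : List C) (f : A → B → C → ℕ) →
  (∑[ x ∈ xs ] ∑[ y ∈ ys ] ∑[ z ∈ zs ] f x y z) ≡ (∑[ y ∈ ys ] ∑[ z ∈ zs ] ∑[ x ∈ xs ] f x y z)
∑-rotate xs ys zs f = trans (∑-swap xs ys _) (∑-cong ys λ y → ∑-swap xs zs λ x z → f x y z)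

term≤∑ : ∀ {n} (f : Fin n → ℕ) i → f i ≤ ∑ (allFin n) f
term≤∑ {suc n} f i rewrite ∑-allFin-suc n f with i
... | zero  = m≤m+n _ _
... | suc j = ≤-trans (term≤∑ (f ∘ suc) j) (m≤n+m _ _)

𝟙 : ∀ {P : Set} → Dec P → ℕ
𝟙 (yes _) = 1
𝟙 (no _)  = 0

𝟙≤1 : ∀ {P : Set} (P? : Dec P) → 𝟙 P? ≤ 1
𝟙≤1 (yes _) = ≤-refl
𝟙≤1 (no _)  = z≤n

∑-𝟙-≟ : ∀ {n} (i : Fin n) → (∑[ j ∈ allFin n ] 𝟙 (i ≟ᶠ j)) ≤ 1
∑-𝟙-≟ {suc n} zero rewrite ∑-allFin-suc n (λ j → 𝟙 (zero ≟ᶠ j)) =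
  s≤s (≤-reflexive (∑-zero (allFin n)))
∑-𝟙-≟ {suc n} (suc i) rewrite ∑-allFin-suc n (λ j → 𝟙 (suc i ≟ᶠ j)) =
  ≤-trans (≤-reflexive (∑-cong (allFin n) λ j → shift (i ≟ᶠ j))) (∑-𝟙-≟ i)
  where
  shift : ∀ {j} (d : Dec (i ≡ j)) → 𝟙 (suc i ≟ᶠ suc j) ≡ 𝟙 (i ≟ᶠ j)
  shift {j} _ with i ≟ᶠ j
  ... | yes _ = refl
  ... | no _  = refl

∃-cube? : ∀ {n} {P : Vec Bool n → Set} → Decidable P → Dec (∃ P)
∃-cube? {zero}  P? = map′ ([] ,_) (λ { ([] , p) → p }) (P? [])
∃-cube? {suc n} P? = map′
  [ (λ (x , p) → false ∷ x , p) , (λ (x , p) → true ∷ x , p) ]′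
  (λ { (false ∷ x , p) → inj₁ (x , p) ; (true ∷ x , p) → inj₂ (x , p) })
  (∃-cube? (P? ∘ (false ∷_)) ⊎-dec ∃-cube? (P? ∘ (true ∷_)))

Intersect : ∀ {n} → Vec Bool n → Vec Bool n → Set
Intersect x y = ∃ λ i → lookup x i ≡ true × lookup y i ≡ true

⊙-∁-disjoint : ∀ {n} (D b : Vec Bool n) → ¬ Intersect (D ⊙ b) (∁ D ⊙ b)
⊙-∁-disjoint (true  ∷ D) (x ∷ b) (zero , _ , ())
⊙-∁-disjoint (false ∷ D) (x ∷ b) (zero , () , _)
⊙-∁-disjoint (d ∷ D) (x ∷ b) (suc i , p , q) = ⊙-∁-disjoint D b (i , p , q)

module Disjointness {n K Ω : ℕ} .{{_ : NonZero n}} .{{_ : NonZero Ω}}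
  (transcript : Fin Ω → Vec Bool n → Vec Bool n → Fin K)
  (Alice Bob : Fin Ω → Vec Bool n → Vec Bool n → Set)
  (Alice? : ∀ ω x y → Dec (Alice ω x y)) (Bob? : ∀ ω x y → Dec (Bob ω x y))
  (paste : ∀ ω {x x′ y y′} → transcript ω x y′ ≡ transcript ω x′ y →
           transcript ω x y ≡ transcript ω x y′ ×
           (Alice ω x y′ → Alice ω x y) × (Bob ω x′ y → Bob ω x y))
  where

  accepts : Fin Ω → Vec Bool n → Vec Bool n → ℕ
  accepts ω x y = 𝟙 (Alice? ω x y ×-dec Bob? ω x y)

  -- By paste, the accepted inputs with transcript τ form the rectangle f ω τ × g ω τ.
  f g : Fin Ω → Fin K → Vec Bool n → ℕ
  f ω τ x = 𝟙 (∃-cube? λ y → (transcript ω x y ≟ᶠ τ) ×-dec Alice? ω x y)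
  g ω τ y = 𝟙 (∃-cube? λ x → (transcript ω x y ≟ᶠ τ) ×-dec Bob? ω x y)

  accepts≤∑ : ∀ ω x y → accepts ω x y ≤ (∑[ τ ∈ allFin K ] (f ω τ x * g ω τ y))
  accepts≤∑ ω x y with Alice? ω x y | Bob? ω x y
  ... | no _  | _     = z≤n
  ... | yes _ | no _  = z≤n
  ... | yes a | yes b = ≤-trans (term (transcript ω x y) refl) (term≤∑ (λ τ → f ω τ x * g ω τ y) (transcript ω x y))
    where
    term : ∀ τ → transcript ω x y ≡ τ → 1 ≤ f ω τ x * g ω τ y
    term τ eq with ∃-cube? (λ y → (transcript ω x y ≟ᶠ τ) ×-dec Alice? ω x y)
                 | ∃-cube? (λ x → (transcript ω x y ≟ᶠ τ) ×-dec Bob? ω x y)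
    ... | yes _ | yes _ = ≤-refl
    ... | no ¬p | _     = contradiction (y , eq , a) ¬p
    ... | yes _ | no ¬p = contradiction (x , eq , b) ¬p

  ∑≤accepts : ∀ ω x y → (∑[ τ ∈ allFin K ] (f ω τ x * g ω τ y)) ≤ accepts ω x y
  ∑≤accepts ω x y = begin
    (∑[ τ ∈ allFin K ] (f ω τ x * g ω τ y))
      ≤⟨ ∑-mono (allFin K) term ⟩
    (∑[ τ ∈ allFin K ] (accepts ω x y * 𝟙 (transcript ω x y ≟ᶠ τ)))
      ≡⟨ ∑-* (allFin K) (accepts ω x y) _ ⟩
    accepts ω x y * (∑[ τ ∈ allFin K ] 𝟙 (transcript ω x y ≟ᶠ τ))
      ≤⟨ *-monoʳ-≤ (accepts ω x y) (∑-𝟙-≟ (transcript ω x y)) ⟩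
    accepts ω x y * 1
      ≡⟨ *-identityʳ _ ⟩
    accepts ω x y ∎
    where
    open ≤-Reasoning
    term : ∀ τ → f ω τ x * g ω τ y ≤ accepts ω x y * 𝟙 (transcript ω x y ≟ᶠ τ)
    term τ with ∃-cube? (λ y → (transcript ω x y ≟ᶠ τ) ×-dec Alice? ω x y)
              | ∃-cube? (λ x → (transcript ω x y ≟ᶠ τ) ×-dec Bob? ω x y)
    ... | no _  | _    = z≤n
    ... | yes _ | no _ = z≤n
    ... | yes (y′ , eq , a) | yes (x′ , eq′ , b)
      with paste ω (trans eq (sym eq′)) | Alice? ω x y | Bob? ω x y | transcript ω x y ≟ᶠ τ
    ... | _ , _ , _  | yes _ | yes _ | yes _ = ≤-refl
    ... | same , _ , _ | _   | _     | no ¬t = contradiction (trans same eq) ¬t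
    ... | _ , keep , _ | no ¬a | _   | _     = contradiction (keep a) ¬a
    ... | _ , _ , keep | _ | no ¬b   | _     = contradiction (keep b) ¬b

  open Rectangle using (M₀; M₁)

  total₀ total₁ : ℕ
  total₀ = ∑[ ω ∈ allFin Ω ] ∑[ τ ∈ allFin K ] M₀ (f ω τ) (g ω τ)
  total₁ = ∑[ ω ∈ allFin Ω ] ∑[ τ ∈ allFin K ] M₁ (f ω τ) (g ω τ)

  P : ℕ
  P = 2 ^ n * 2 ^ n

  ∑∑-const : ∀ c → (∑[ D ∈ cube n ] ∑[ b ∈ cube n ] c) ≡ P * c
  ∑∑-const c = trans (∑-cong (cube n) λ D → ∑-const (cube n) c)
    (trans (∑-const (cube n) _) (trans (cong (λ l → l * (l * c)) (length-cube n)) (sym (*-assoc (2 ^ n) (2 ^ n) c))))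

  total₀-bound : (∀ x y → ¬ Intersect x y → 2 * Ω ≤ 3 * (∑[ ω ∈ allFin Ω ] accepts ω x y)) →
                 P * (2 * Ω) ≤ 3 * total₀
  total₀-bound many = begin
    P * (2 * Ω)                                        ≡⟨ ∑∑-const (2 * Ω) ⟨
    (∑[ D ∈ cube n ] ∑[ b ∈ cube n ] (2 * Ω))
      ≤⟨ ∑-mono (cube n) (λ D → ∑-mono (cube n) λ b → many _ _ (⊙-∁-disjoint D b)) ⟩
    (∑[ D ∈ cube n ] ∑[ b ∈ cube n ] (3 * (∑[ ω ∈ allFin Ω ] accepts ω (D ⊙ b) (∁ D ⊙ b))))
      ≡⟨ trans (∑-cong (cube n) λ D → ∑-* (cube n) 3 _) (∑-* (cube n) 3 _) ⟩
    3 * (∑[ D ∈ cube n ] ∑[ b ∈ cube n ] ∑[ ω ∈ allFin Ω ] accepts ω (D ⊙ b) (∁ D ⊙ b))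
      ≡⟨ cong (3 *_) (∑-rotate (allFin Ω) (cube n) (cube n) _) ⟨
    3 * (∑[ ω ∈ allFin Ω ] ∑[ D ∈ cube n ] ∑[ b ∈ cube n ] accepts ω (D ⊙ b) (∁ D ⊙ b))
      ≤⟨ *-monoʳ-≤ 3 (∑-mono (allFin Ω) λ ω → ∑-mono (cube n) λ D → ∑-mono (cube n) λ b → accepts≤∑ ω _ _) ⟩
    3 * (∑[ ω ∈ allFin Ω ] ∑[ D ∈ cube n ] ∑[ b ∈ cube n ] ∑[ τ ∈ allFin K ] (f ω τ (D ⊙ b) * g ω τ (∁ D ⊙ b)))
      ≡⟨ cong (3 *_) (∑-cong (allFin Ω) λ ω → ∑-rotate (allFin K) (cube n) (cube n) _) ⟨
    3 * total₀ ∎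
    where open ≤-Reasoning

  total₁-bound : (∀ x y → Intersect x y → 3 * (∑[ ω ∈ allFin Ω ] accepts ω x y) ≤ Ω) →
                 3 * total₁ ≤ n * (P * Ω)
  total₁-bound few = begin
    3 * total₁
      ≡⟨ cong (3 *_) (∑-cong (allFin Ω) λ ω → trans (∑-swap (allFin K) (allFin n) _)
           (∑-cong (allFin n) λ i → ∑-rotate (allFin K) (cube n) (cube n) _)) ⟩
    3 * (∑[ ω ∈ allFin Ω ] ∑[ i ∈ allFin n ] ∑[ D ∈ cube n ] ∑[ b ∈ cube n ] ∑[ τ ∈ allFin K ]
           (f ω τ ((D ⊙ b) [ i ]≔ true) * g ω τ ((∁ D ⊙ b) [ i ]≔ true)))
      ≤⟨ *-monoʳ-≤ 3 (∑-mono (allFin Ω) λ ω → ∑-mono (allFin n) λ i → ∑-mono (cube n) λ D → ∑-mono (cube n) λ b → ∑≤accepts ω _ _) ⟩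
    3 * (∑[ ω ∈ allFin Ω ] ∑[ i ∈ allFin n ] ∑[ D ∈ cube n ] ∑[ b ∈ cube n ]
           accepts ω ((D ⊙ b) [ i ]≔ true) ((∁ D ⊙ b) [ i ]≔ true))
      ≡⟨ cong (3 *_) (trans (∑-swap (allFin Ω) (allFin n) _) (∑-cong (allFin n) λ i → ∑-rotate (allFin Ω) (cube n) (cube n) _)) ⟩
    3 * (∑[ i ∈ allFin n ] ∑[ D ∈ cube n ] ∑[ b ∈ cube n ] ∑[ ω ∈ allFin Ω ]
           accepts ω ((D ⊙ b) [ i ]≔ true) ((∁ D ⊙ b) [ i ]≔ true))
      ≡⟨ trans (∑-cong (allFin n) λ i → trans (∑-cong (cube n) λ D → ∑-* (cube n) 3 _) (∑-* (cube n) 3 _)) (∑-* (allFin n) 3 _) ⟨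
    (∑[ i ∈ allFin n ] ∑[ D ∈ cube n ] ∑[ b ∈ cube n ] (3 * (∑[ ω ∈ allFin Ω ]
           accepts ω ((D ⊙ b) [ i ]≔ true) ((∁ D ⊙ b) [ i ]≔ true))))
      ≤⟨ ∑-mono (allFin n) (λ i → ∑-mono (cube n) λ D → ∑-mono (cube n) λ b → few _ _
           (i , lookup∘update i (D ⊙ b) true , lookup∘update i (∁ D ⊙ b) true)) ⟩
    (∑[ i ∈ allFin n ] ∑[ D ∈ cube n ] ∑[ b ∈ cube n ] Ω)
      ≡⟨ trans (∑-cong (allFin n) λ i → ∑∑-const Ω) (trans (∑-const (allFin n) _) (cong (_* (P * Ω)) (length-tabulate {n = n} (λ i → i)))) ⟩
    n * (P * Ω) ∎
    where open ≤-Reasoning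

  total-corruption : ∀ c q → (∀ ω τ → 31 * (2 ^ q * (n * M₀ (f ω τ) (g ω τ))) ≤ 60 * (2 ^ q * M₁ (f ω τ) (g ω τ)) + c) →
                     31 * (2 ^ q * (n * total₀)) ≤ 60 * (2 ^ q * total₁) + Ω * (K * c)
  total-corruption c q each = begin
    31 * (2 ^ q * (n * total₀))
      ≡⟨ pull₃ ⟨
    (∑[ ω ∈ allFin Ω ] ∑[ τ ∈ allFin K ] (31 * (2 ^ q * (n * m₀ ω τ))))
      ≤⟨ ∑-mono (allFin Ω) (λ ω → ∑-mono (allFin K) λ τ → each ω τ) ⟩
    (∑[ ω ∈ allFin Ω ] ∑[ τ ∈ allFin K ] (60 * (2 ^ q * m₁ ω τ) + c))
      ≡⟨ trans (∑-cong (allFin Ω) λ ω → ∑-+ (allFin K) _ _) (∑-+ (allFin Ω) _ _) ⟩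
    (∑[ ω ∈ allFin Ω ] ∑[ τ ∈ allFin K ] (60 * (2 ^ q * m₁ ω τ))) + (∑[ ω ∈ allFin Ω ] ∑[ τ ∈ allFin K ] c)
      ≡⟨ cong₂ _+_ (trans (pull 60 _) (cong (60 *_) (pull (2 ^ q) _)))
           (trans (∑-cong (allFin Ω) λ ω → trans (∑-const (allFin K) c) (cong (_* c) (length-tabulate {n = K} (λ i → i))))
             (trans (∑-const (allFin Ω) _) (cong (_* (K * c)) (length-tabulate {n = Ω} (λ i → i))))) ⟩
    60 * (2 ^ q * total₁) + Ω * (K * c) ∎
    where
    open ≤-Reasoning
    m₀ m₁ : Fin Ω → Fin K → ℕ
    m₀ ω τ = M₀ (f ω τ) (g ω τ)
    m₁ ω τ = M₁ (f ω τ) (g ω τ)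
    pull : ∀ a (φ : Fin Ω → Fin K → ℕ) → (∑[ ω ∈ allFin Ω ] ∑[ τ ∈ allFin K ] (a * φ ω τ)) ≡
                                          a * (∑[ ω ∈ allFin Ω ] ∑[ τ ∈ allFin K ] φ ω τ)
    pull a φ = trans (∑-cong (allFin Ω) λ ω → ∑-* (allFin K) a _) (∑-* (allFin Ω) a _)
    pull₃ : (∑[ ω ∈ allFin Ω ] ∑[ τ ∈ allFin K ] (31 * (2 ^ q * (n * m₀ ω τ)))) ≡ 31 * (2 ^ q * (n * total₀))
    pull₃ = trans (pull 31 _) (cong (31 *_) (trans (pull (2 ^ q) _) (cong (2 ^ q *_) (pull n m₀))))

  many-transcripts :
    (∀ x y → ¬ Intersect x y → 2 * Ω ≤ 3 * (∑[ ω ∈ allFin Ω ] accepts ω x y)) →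
    (∀ x y → Intersect x y → 3 * (∑[ ω ∈ allFin Ω ] accepts ω x y) ≤ Ω) →
    ∀ q → 128 * (36 * q) ≤ n → 2 * 2 ^ q ≤ 3 * 128 * K
  many-transcripts many few q q-small =
    cancel 128 (2 ^ q) (n * Ω * P) {{m*n≢0 (n * Ω) P {{m*n≢0 n Ω}} {{m*n≢0 (2 ^ n) (2 ^ n) {{m^n≢0 2 n}} {{m^n≢0 2 n}}}}}} (begin
    62 * (2 ^ q * (n * Ω * P))                  ≡⟨ e₁ (2 ^ q) n Ω P ⟩
    31 * (2 ^ q * (n * (P * (2 * Ω))))          ≤⟨ *-monoʳ-≤ 31 (*-monoʳ-≤ (2 ^ q) (*-monoʳ-≤ n (total₀-bound many))) ⟩
    31 * (2 ^ q * (n * (3 * total₀)))           ≡⟨ e₂ (2 ^ q) n total₀ ⟩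
    3 * (31 * (2 ^ q * (n * total₀)))
      ≤⟨ *-monoʳ-≤ 3 (total-corruption _ q λ ω τ → Rectangle.corruption (f ω τ) (g ω τ) (λ x → 𝟙≤1 _) (λ y → 𝟙≤1 _) q q-small) ⟩
    3 * (60 * (2 ^ q * total₁) + Ω * (K * (128 * (n * P))))
                                                ≡⟨ e₃ (2 ^ q) total₁ Ω K 128 n P ⟩
    60 * (2 ^ q * (3 * total₁)) + 3 * (Ω * (K * (128 * (n * P))))
      ≤⟨ +-monoˡ-≤ _ (*-monoʳ-≤ 60 (*-monoʳ-≤ (2 ^ q) (total₁-bound few))) ⟩
    60 * (2 ^ q * (n * (P * Ω))) + 3 * (Ω * (K * (128 * (n * P))))
                                                ≡⟨ e₄ (2 ^ q) Ω K 128 n P ⟩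
    60 * (2 ^ q * (n * Ω * P)) + 3 * 128 * (K * (n * Ω * P)) ∎)
    where
    open ≤-Reasoning
    e₁ : ∀ t n o p → 62 * (t * (n * o * p)) ≡ 31 * (t * (n * (p * (2 * o))))
    e₁ = solve-∀
    e₂ : ∀ t n s → 31 * (t * (n * (3 * s))) ≡ 3 * (31 * (t * (n * s)))
    e₂ = solve-∀
    e₃ : ∀ t s o k c n p → 3 * (60 * (t * s) + o * (k * (c * (n * p)))) ≡ 60 * (t * (3 * s)) + 3 * (o * (k * (c * (n * p))))
    e₃ = solve-∀
    e₄ : ∀ t o k c n p → 60 * (t * (n * (p * o))) + 3 * (o * (k * (c * (n * p)))) ≡ 60 * (t * (n * o * p)) + 3 * c * (k * (n * o * p))
    e₄ = solve-∀
    cancel : ∀ c t x → .{{NonZero x}} → 62 * (t * x) ≤ 60 * (t * x) + 3 * c * (K * x) → 2 * t ≤ 3 * c * K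
    cancel c t x le = *-cancelʳ-≤ (2 * t) (3 * c * K) x (+-cancelˡ-≤ (60 * (t * x)) _ _ (begin
      60 * (t * x) + 2 * t * x       ≡⟨ e₅ t x ⟩
      62 * (t * x)                   ≤⟨ le ⟩
      60 * (t * x) + 3 * c * (K * x) ≡⟨ cong (60 * (t * x) +_) (*-assoc (3 * c) K x) ⟨
      60 * (t * x) + 3 * c * K * x   ∎))
      where
      e₅ : ∀ t x → 60 * (t * x) + 2 * t * x ≡ 62 * (t * x)
      e₅ = solve-∀

-- Simulation of a protocol by two players

bit : Bool → Fin 3
bit false = suc zero
bit true  = suc (suc zero)

encode : ∀ L → List Bool → Fin (3 ^ L)
encode zero    _        = zero
encode (suc L) []       = combine {3} zero (encode L [])
encode (suc L) (b ∷ bs) = combine (bit b) (encode L bs)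

bit-injective : ∀ b b′ → bit b ≡ bit b′ → b ≡ b′
bit-injective true  true  _ = refl
bit-injective false false _ = refl

encode-injective : ∀ L bs bs′ → List.length bs ≤ L → List.length bs′ ≤ L → encode L bs ≡ encode L bs′ → bs ≡ bs′
encode-injective L       []       []         _ _ _ = refl
encode-injective (suc L) []       (true ∷ bs′) _ _ eq with combine-injective {3} zero _ (suc (suc zero)) _ eq
... | () , _
encode-injective (suc L) []       (false ∷ bs′) _ _ eq with combine-injective {3} zero _ (suc zero) _ eq
... | () , _
encode-injective (suc L) (true ∷ bs) []       _ _ eq with combine-injective {3} (suc (suc zero)) _ zero _ eq
... | () , _
encode-injective (suc L) (false ∷ bs) []      _ _ eq with combine-injective {3} (suc zero) _ zero _ eq
... | () , _
encode-injective (suc L) (b ∷ bs) (b′ ∷ bs′) (s≤s l) (s≤s l′) eq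
  with same , rest ← combine-injective (bit b) (encode L bs) (bit b′) (encode L bs′) eq =
  cong₂ _∷_ (bit-injective b b′ same) (encode-injective L bs bs′ l l′ rest)

toList-injective : ∀ {m n} (xs : Vec Bool m) (ys : Vec Bool n) → toList xs ≡ toList ys →
                   _≡_ {A = ∃ (Vec Bool)} (m , xs) (n , ys)
toList-injective []       []       _    = refl
toList-injective (x ∷ xs) (y ∷ ys) eq with refl , rest ← ∷-injective eq with refl ← toList-injective xs ys rest = refl

length-toList : ∀ {m} (xs : Vec Bool m) → List.length (toList xs) ≡ m
length-toList []       = refl
length-toList (_ ∷ xs) = cong suc (length-toList xs)

code : ∀ {L} → Message L → Fin (3 ^ L)
code {L} m = encode L (Vec≤.toList m)

length-message : ∀ {L} (m : Message L) → List.length (Vec≤.toList m) ≤ L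
length-message {L} m = subst (_≤ L) (sym (length-toList (Vec≤.toVec m))) (Vec≤.isBounded m)

code-injective : ∀ {L} (m m′ : Message L) → code m ≡ code m′ → m ≡ m′
code-injective {L} m@(Vec≤._,_ xs _) m′@(Vec≤._,_ ys _) eq
  with refl ← toList-injective xs ys
                (encode-injective L (toList xs) (toList ys) (length-message m) (length-message m′) eq) = refl

funToFin-cong : ∀ {m n} {f g : Fin m → Fin n} → (∀ i → f i ≡ g i) → funToFin f ≡ funToFin g
funToFin-cong {zero}  f≗g = refl
funToFin-cong {suc m} f≗g = cong₂ combine (f≗g zero) (funToFin-cong (f≗g ∘ suc))

funToFin-injective : ∀ {m n} {f g : Fin m → Fin n} → funToFin f ≡ funToFin g → ∀ i → f i ≡ g i
funToFin-injective {f = f} {g} eq i =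
  trans (sym (finToFun-funToFin f i)) (trans (cong (λ k → finToFun k i) eq) (finToFun-funToFin g i))

linkedIn : ∀ {n W} → LocalInput n W → Fin n → Bool
linkedIn ℓ u = is-just (lookup (LocalInput.incoming ℓ) u) ∨ is-just (lookup (LocalInput.outgoing ℓ) u)

linked≡linkedIn : ∀ {n W} (I : Instance n W) u v →
                  Digraph.linked (Instance.graph I) u v ≡ linkedIn (localView I v) u
linked≡linkedIn I u v = sym (cong₂ (λ x y → is-just x ∨ is-just y)
  (lookup∘tabulate (λ u → entry u v) u) (lookup∘tabulate (entry v) u))
  where open Digraph (Instance.graph I)

module Simulation {Output X : Set} {n W L c : ℕ} (A : Protocol Output n W L) (I : X → X → Instance n W)
  (side : Fin n → Bool)
  (viewA : ∀ {v} x {y y′} → side v ≡ true → localView (I x y) v ≡ localView (I x y′) v)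
  (viewB : ∀ {v} {x x′} y → side v ≡ false → localView (I x y) v ≡ localView (I x′ y) v)
  (left right : Fin c → Fin n) (left-side : ∀ e → side (left e) ≡ true) (right-side : ∀ e → side (right e) ≡ false)
  (cut : ∀ x y u v → side u ≡ true → side v ≡ false → Digraph.linked (Instance.graph (I x y)) u v ≡ true →
         ∃ λ e → left e ≡ u × right e ≡ v)
  (claims : Output → Bool)
  where

  open Protocol A

  Ω : ℕ
  Ω = randomness ^ n

  σ : ℕ → Fin Ω → X → X → Fin n → State
  σ r ω x y v = lookup (statesAfter A (I x y) r (finToFun ω)) v

  linked : X → X → Fin n → Fin n → Bool
  linked x y = Digraph.linked (Instance.graph (I x y))

  linked-sym : ∀ x y u v → linked x y u v ≡ linked x y v u
  linked-sym x y u v = ∨-comm (is-just (Digraph.entry (Instance.graph (I x y)) u v)) _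

  message : ℕ → Fin Ω → X → X → Fin n → Fin n → Message L
  message r ω x y u v = send (σ r ω x y u) v

  exchange : ℕ → Fin Ω → X → X → Fin c → Fin (3 ^ L * 3 ^ L)
  exchange r ω x y e = combine (code (message r ω x y (left e) (right e))) (code (message r ω x y (right e) (left e)))

  K : ℕ
  K = ((3 ^ L * 3 ^ L) ^ c) ^ rounds

  transcript : Fin Ω → X → X → Fin K
  transcript ω x y = funToFin {rounds} λ r → funToFin {c} (exchange (toℕ r) ω x y)

  transcript-exchange : ∀ {ω x x′ y y′} → transcript ω x y ≡ transcript ω x′ y′ →
                        ∀ {r} → r < rounds → ∀ e → exchange r ω x y e ≡ exchange r ω x′ y′ e
  transcript-exchange {ω} {x} {x′} {y} {y′} eq {r} r<R e =
    subst (λ r → exchange r ω x y e ≡ exchange r ω x′ y′ e) (toℕ-fromℕ< r<R)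
      (funToFin-injective (funToFin-injective eq (fromℕ< r<R)) e)

  σ-suc : ∀ r ω x y v → σ (suc r) ω x y v ≡
          receive (σ r ω x y v) (tabulate λ u → if linked x y u v then just (message r ω x y u v) else nothing)
  σ-suc r ω x y v = lookup∘tabulate _ v

  received-cong : ∀ (r : ℕ) ω {x x′ y y′} v → localView (I x y) v ≡ localView (I x′ y′) v →
    σ r ω x y v ≡ σ r ω x′ y′ v →
    (∀ u → linked x′ y′ u v ≡ true → message r ω x y u v ≡ message r ω x′ y′ u v) →
    σ (suc r) ω x y v ≡ σ (suc r) ω x′ y′ v
  received-cong r ω {x} {x′} {y} {y′} v view same heard =
    trans (σ-suc r ω x y v) (trans (cong₂ receive same (tabulate-cong inbox)) (sym (σ-suc r ω x′ y′ v)))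
    where
    inbox : ∀ u → (if linked x y u v then just (message r ω x y u v) else nothing) ≡
                  (if linked x′ y′ u v then just (message r ω x′ y′ u v) else nothing)
    inbox u rewrite trans (linked≡linkedIn (I x y) u v)
                      (trans (cong (λ ℓ → linkedIn ℓ u) view) (sym (linked≡linkedIn (I x′ y′) u v)))
      with linked x′ y′ u v in eq
    ... | true  = cong just (heard u eq)
    ... | false = refl

  module _ {ω x x′ y y′} (same : transcript ω x y′ ≡ transcript ω x′ y) where

    cut-message : ∀ {r} → r < rounds → ∀ e →
      message r ω x y′ (left e) (right e) ≡ message r ω x′ y (left e) (right e) ×
      message r ω x y′ (right e) (left e) ≡ message r ω x′ y (right e) (left e)
    cut-message r<R e with p , q ← combine-injective _ _ _ _ (transcript-exchange same r<R e) =
      code-injective _ _ p , code-injective _ _ q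

    paste-states : ∀ r → r ≤ rounds →
      (∀ v → side v ≡ true  → σ r ω x y v ≡ σ r ω x y′ v) ×
      (∀ v → side v ≡ false → σ r ω x y v ≡ σ r ω x′ y v)
    paste-states zero    _ =
      (λ v s → start {x} {x} {y} {y′} v (viewA x s)) , (λ v s → start {x} {x′} {y} {y} v (viewB y s))
      where
      start : ∀ {x x′ y y′} v → localView (I x y) v ≡ localView (I x′ y′) v → σ 0 ω x y v ≡ σ 0 ω x′ y′ v
      start v view = trans (lookup∘tabulate _ v)
        (trans (cong (λ ℓ → init ℓ (finToFun ω v)) view) (sym (lookup∘tabulate _ v)))
    paste-states (suc r) r<R with ihA , ihB ← paste-states r (<⇒≤ r<R) =
      (λ v s → received-cong r ω {x} {x} {y} {y′} v (viewA x s) (ihA v s) (hearA v s)) ,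
      (λ v s → received-cong r ω {x} {x′} {y} {y} v (viewB y s) (ihB v s) (hearB v s))
      where
      hearA : ∀ v → side v ≡ true → ∀ u → linked x y′ u v ≡ true → message r ω x y u v ≡ message r ω x y′ u v
      hearA v s u link with side u in side-u
      ... | true  = cong (λ st → send st v) (ihA u side-u)
      ... | false with e , refl , refl ← cut x y′ v u s side-u (trans (linked-sym x y′ v u) link) =
        trans (cong (λ st → send st v) (ihB u side-u)) (sym (proj₂ (cut-message r<R e)))
      hearB : ∀ v → side v ≡ false → ∀ u → linked x′ y u v ≡ true → message r ω x y u v ≡ message r ω x′ y u v
      hearB v s u link with side u in side-u
      ... | false = cong (λ st → send st v) (ihB u side-u)
      ... | true with e , refl , refl ← cut x′ y u v side-u s link =
        trans (cong (λ st → send st v) (ihA u side-u)) (proj₁ (cut-message r<R e))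

  Silent : Bool → Fin Ω → X → X → Set
  Silent s ω x y = ∀ v → side v ≡ s → claims (outputs A (I x y) (finToFun ω) v) ≡ false

  Silent? : ∀ s ω x y → Dec (Silent s ω x y)
  Silent? s ω x y = all? λ v → (side v ≟ᵇ s) →-dec (claims (outputs A (I x y) (finToFun ω) v) ≟ᵇ false)

  paste : ∀ ω {x x′ y y′} → transcript ω x y′ ≡ transcript ω x′ y →
          transcript ω x y ≡ transcript ω x y′ ×
          (Silent true ω x y′ → Silent true ω x y) × (Silent false ω x′ y → Silent false ω x y)
  paste ω {x} {x′} {y} {y′} same =
    funToFin-cong (λ r → funToFin-cong λ e → transcript-step (toℕ r) (toℕ<n r) e) ,
    (λ silent v s → trans (cong (claims ∘ output) (proj₁ (paste-states same rounds ≤-refl) v s)) (silent v s)) ,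
    (λ silent v s → trans (cong (claims ∘ output) (proj₂ (paste-states same rounds ≤-refl) v s)) (silent v s))
    where
    transcript-step : ∀ r → r < rounds → ∀ e → exchange r ω x y e ≡ exchange r ω x y′ e
    transcript-step r r<R e with ihA , ihB ← paste-states same r (<⇒≤ r<R) =
      cong₂ combine
        (cong (λ st → code (send st (right e))) (ihA (left e) (left-side e)))
        (cong code (trans (cong (λ st → send st (left e)) (ihB (right e) (right-side e)))
                          (sym (proj₂ (cut-message same r<R e)))))

-- The hard graphs

module _ {n : ℕ} {R : Fin n → Fin n → Set} (rank : Fin n → ℕ) where

  Climbs : ∀ {u t} → Star R u t → Set
  Climbs ε                       = ⊤
  Climbs {u} (_◅_ {j = v} _ w) = rank u < rank v × Climbs w

  climbs⇒≤ : ∀ {u t} (w : Star R u t) → Climbs w → All (λ v → rank u ≤ rank v) (vertices w)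
  climbs⇒≤ ε       _             = ≤-refl ∷ []
  climbs⇒≤ (_ ◅ w) (u<v , climb) = ≤-refl ∷ All.map (≤-trans (<⇒≤ u<v)) (climbs⇒≤ w climb)

  climbs⇒unique : ∀ {u t} (w : Star R u t) → Climbs w → Unique (vertices w)
  climbs⇒unique ε       _             = [] ∷ []
  climbs⇒unique (_ ◅ w) (u<v , climb) =
    All.map (λ v≤z u≡z → <⇒≢ (<-≤-trans u<v v≤z) (cong rank u≡z)) (climbs⇒≤ w climb) ∷ climbs⇒unique w climb

when : ∀ {A P : Set} → Dec P → A → Maybe A
when (yes _) a = just a
when (no _)  _ = nothing

when-just : ∀ {A P : Set} (P? : Dec P) {a b : A} → when P? a ≡ just b → P × a ≡ b
when-just (yes p) refl = p , refl

when-true : ∀ {A P : Set} (P? : Dec P) {a : A} → P → when P? a ≡ just a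
when-true (yes _) p = refl
when-true (no ¬p) p = contradiction p ¬p

if-just : ∀ {A : Set} b {a c : A} → (if b then just a else nothing) ≡ just c → b ≡ true × a ≡ c
if-just true refl = refl , refl

module HardGraph (κ r : ℕ) where

  k n : ℕ
  k = suc κ
  n = suc (k + (k + (k + (k + r))))

  data Role : Set where
    hub           : Role
    p q v v′      : Fin k → Role
    spare         : Fin r → Role

  abstract
    vertex : Role → Fin n
    vertex hub       = zero
    vertex (p i)     = suc (i ↑ˡ _)
    vertex (q i)     = suc (k ↑ʳ (i ↑ˡ _))
    vertex (v i)     = suc (k ↑ʳ (k ↑ʳ (i ↑ˡ _)))
    vertex (v′ i)    = suc (k ↑ʳ (k ↑ʳ (k ↑ʳ (i ↑ˡ _))))
    vertex (spare i) = suc (k ↑ʳ (k ↑ʳ (k ↑ʳ (k ↑ʳ i))))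

    role : Fin n → Role
    role zero    = hub
    role (suc u) = [ p , (λ u → [ q , (λ u → [ v , (λ u → [ v′ , spare ]′ (splitAt k u)) ]′ (splitAt k u)) ]′ (splitAt k u)) ]′ (splitAt k u)

    role-vertex : ∀ ρ → role (vertex ρ) ≡ ρ
    role-vertex hub = refl
    role-vertex (p i) rewrite splitAt-↑ˡ k i (k + (k + (k + r))) = refl
    role-vertex (q i)
      rewrite splitAt-↑ʳ k (k + (k + (k + r))) (i ↑ˡ (k + (k + r))) | splitAt-↑ˡ k i (k + (k + r)) = refl
    role-vertex (v i)
      rewrite splitAt-↑ʳ k (k + (k + (k + r))) (k ↑ʳ (i ↑ˡ (k + r))) | splitAt-↑ʳ k (k + (k + r)) (i ↑ˡ (k + r))
            | splitAt-↑ˡ k i (k + r) = refl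
    role-vertex (v′ i)
      rewrite splitAt-↑ʳ k (k + (k + (k + r))) (k ↑ʳ (k ↑ʳ (i ↑ˡ r))) | splitAt-↑ʳ k (k + (k + r)) (k ↑ʳ (i ↑ˡ r))
            | splitAt-↑ʳ k (k + r) (i ↑ˡ r) | splitAt-↑ˡ k i r = refl
    role-vertex (spare i)
      rewrite splitAt-↑ʳ k (k + (k + (k + r))) (k ↑ʳ (k ↑ʳ (k ↑ʳ i))) | splitAt-↑ʳ k (k + (k + r)) (k ↑ʳ (k ↑ʳ i))
            | splitAt-↑ʳ k (k + r) (k ↑ʳ i) | splitAt-↑ʳ k r i = refl

    vertex-role : ∀ u → vertex (role u) ≡ u
    vertex-role zero = refl
    vertex-role (suc u) with splitAt k u in e₁
    ... | inj₁ i = cong suc (splitAt⁻¹-↑ˡ e₁)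
    ... | inj₂ u₁ with splitAt k u₁ in e₂
    ... | inj₁ i = cong suc (trans (cong (k ↑ʳ_) (splitAt⁻¹-↑ˡ e₂)) (splitAt⁻¹-↑ʳ e₁))
    ... | inj₂ u₂ with splitAt k u₂ in e₃
    ... | inj₁ i = cong suc (trans (cong (k ↑ʳ_) (trans (cong (k ↑ʳ_) (splitAt⁻¹-↑ˡ e₃)) (splitAt⁻¹-↑ʳ e₂))) (splitAt⁻¹-↑ʳ e₁))
    ... | inj₂ u₃ with splitAt k u₃ in e₄
    ... | inj₁ i = cong suc (trans (cong (k ↑ʳ_) (trans (cong (k ↑ʳ_) (trans (cong (k ↑ʳ_)
                     (splitAt⁻¹-↑ˡ e₄)) (splitAt⁻¹-↑ʳ e₃))) (splitAt⁻¹-↑ʳ e₂))) (splitAt⁻¹-↑ʳ e₁))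
    ... | inj₂ i = cong suc (trans (cong (k ↑ʳ_) (trans (cong (k ↑ʳ_) (trans (cong (k ↑ʳ_)
                     (splitAt⁻¹-↑ʳ e₄)) (splitAt⁻¹-↑ʳ e₃))) (splitAt⁻¹-↑ʳ e₂))) (splitAt⁻¹-↑ʳ e₁))

  vertex-injective : ∀ {ρ σ} → vertex ρ ≡ vertex σ → ρ ≡ σ
  vertex-injective {ρ} {σ} eq = trans (sym (role-vertex ρ)) (trans (cong role eq) (role-vertex σ))

  Bits : Set
  Bits = Vec Bool (k * k)

  alice : Role → Bool
  alice (q _)  = false
  alice (v′ _) = false
  alice _      = true

  select : Bool → Bool → Bool → Bool → Bool
  select true  true  a b = a
  select false false a b = b
  select _     _     a b = false

  -- Which input bit decides the arc; zero is a junk value for arcs that are always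
  -- present or absent.
  index : Role → Role → Fin (k * k)
  index (p i)  (v j) = combine i j
  index (v′ j) (q i) = combine i j
  index _      _     = zero

  arc′ : Bool → Role → Role → Maybe (Fin k)
  arc′ _ hub       _     = nothing
  arc′ _ (p _)     hub   = just zero
  arc′ _ (q _)     hub   = just zero
  arc′ _ (v _)     hub   = just zero
  arc′ _ (v′ _)    hub   = just zero
  arc′ _ (spare _) hub   = just zero
  arc′ _ (p i)     (q j) = when (i ≟ᶠ j) zero
  arc′ _ (q i)     (p j) = when (toℕ j ≟ⁿ suc (toℕ i)) zero
  arc′ b (p i)     (v _) = if b then just (opposite i) else nothing
  arc′ _ (v i)    (v′ j) = when (i ≟ᶠ j) zero
  arc′ b (v′ _)    (q i) = if b then just i else nothing
  arc′ _ _         _     = nothing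

  arc : Bits → Bits → Role → Role → Maybe (Fin k)
  arc x y ρ σ = arc′ (select (alice ρ) (alice σ) (lookup x (index ρ σ)) (lookup y (index ρ σ))) ρ σ

  arc-loopless : ∀ x y ρ → arc x y ρ ρ ≡ nothing
  arc-loopless x y hub       = refl
  arc-loopless x y (p _)     = refl
  arc-loopless x y (q _)     = refl
  arc-loopless x y (v _)     = refl
  arc-loopless x y (v′ _)    = refl
  arc-loopless x y (spare _) = refl

  arc-x-free : ∀ x x′ y ρ σ → alice ρ ≡ false ⊎ alice σ ≡ false → arc x y ρ σ ≡ arc x′ y ρ σ
  arc-x-free x x′ y ρ σ side = cong (λ b → arc′ b ρ σ) (free (alice ρ) (alice σ) side)
    where
    free : ∀ s t {a a′ b} → s ≡ false ⊎ t ≡ false → select s t a b ≡ select s t a′ b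
    free true  false _ = refl
    free false true  _ = refl
    free false false _ = refl
    free true  true  (inj₁ ())
    free true  true  (inj₂ ())

  arc-y-free : ∀ x y y′ ρ σ → alice ρ ≡ true ⊎ alice σ ≡ true → arc x y ρ σ ≡ arc x y′ ρ σ
  arc-y-free x y y′ ρ σ side = cong (λ b → arc′ b ρ σ) (free (alice ρ) (alice σ) side)
    where
    free : ∀ s t {a b b′} → s ≡ true ⊎ t ≡ true → select s t a b ≡ select s t a b′
    free true  false _ = refl
    free false true  _ = refl
    free true  true  _ = refl
    free false false (inj₁ ())
    free false false (inj₂ ())

  infix 4 _⇝_
  data _⇝_ : Fin k → Fin k → Set where
    stop : ∀ {a} → a ⇝ a
    next : ∀ {a a⁺ b} → toℕ a⁺ ≡ suc (toℕ a) → a⁺ ⇝ b → a ⇝ b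

  ⇝⇒≤ : ∀ {a b} → a ⇝ b → toℕ a ≤ toℕ b
  ⇝⇒≤ stop          = ≤-refl
  ⇝⇒≤ (next a⁺≡ a⇝) = ≤-trans (n≤1+n _) (≤-trans (≤-reflexive (sym a⁺≡)) (⇝⇒≤ a⇝))

  reach : ∀ d {a b} → toℕ a + d ≡ toℕ b → a ⇝ b
  reach zero    eq with refl ← toℕ-injective (trans (sym (+-identityʳ _)) eq) = stop
  reach (suc d) {a} {b} eq = next (toℕ-fromℕ< a⁺<k) (reach d (trans (cong (_+ d) (toℕ-fromℕ< a⁺<k)) (trans (sym (+-suc _ d)) eq)))
    where
    a⁺<k : suc (toℕ a) < k
    a⁺<k = ≤-<-trans (≤-trans (m≤m+n _ d) (≤-reflexive (trans (sym (+-suc (toℕ a) d)) eq))) (toℕ<n b)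

  last : Fin k
  last = fromℕ κ

  from-start : ∀ b → zero ⇝ b
  from-start b = reach (toℕ b) refl

  to-end : ∀ a → a ⇝ last
  to-end a = reach (κ ∸ toℕ a) (trans (m+[n∸m]≡n (toℕ≤pred[n] a)) (sym (toℕ-fromℕ κ)))

  module Weighted (W : ℕ) (κ≤W : κ ≤ W) where

    embed : Fin k → Fin (suc W)
    embed i = inject≤ i (s≤s κ≤W)

    module Graph (x y : Bits) where

      cell : Fin n → Fin n → Maybe (Fin (suc W))
      cell u w = Maybe.map embed (arc x y (role u) (role w))

      lookup-cell : ∀ u w → lookup (lookup (tabulate λ u → tabulate (cell u)) u) w ≡ cell u w
      lookup-cell u w = trans (cong (λ row → lookup row w) (lookup∘tabulate (λ u → tabulate (cell u)) u))
                              (lookup∘tabulate (cell u) w)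

      graph : Digraph n W
      graph = record
        { matrix   = tabulate λ u → tabulate (cell u)
        ; loopless = λ u → trans (lookup-cell u u) (cong (Maybe.map embed) (arc-loopless x y (role u)))
        }

      open Digraph graph

      entry≡ : ∀ u w → entry u w ≡ cell u w
      entry≡ = lookup-cell

      edge : ∀ {ρ σ w} → arc x y ρ σ ≡ just w → Edge (vertex ρ) (vertex σ)
      edge {ρ} {σ} {w} eq = embed w , trans (entry≡ (vertex ρ) (vertex σ))
        (cong (Maybe.map embed) (trans (cong₂ (arc x y) (role-vertex ρ) (role-vertex σ)) eq))

      invert : ∀ {ρ u} ((c , _) : Edge (vertex ρ) u) →
               ∃₂ λ σ w → u ≡ vertex σ × arc x y ρ σ ≡ just w × toℕ c ≡ toℕ w
      invert {ρ} {u} (c , eq) with trans (sym (trans (entry≡ (vertex ρ) u)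
                                       (cong (λ τ → Maybe.map embed (arc x y τ (role u))) (role-vertex ρ)))) eq
      ... | eq′ with arc x y ρ (role u) in found | eq′
      ... | just w | refl = role u , w , sym (vertex-role u) , found , toℕ-inject≤ w _

      along : ∀ a → arc x y (p a) (q a) ≡ just zero
      along a = when-true (a ≟ᶠ a) refl

      onward : ∀ {a b} → toℕ b ≡ suc (toℕ a) → arc x y (q a) (p b) ≡ just zero
      onward {a} {b} eq = when-true (toℕ b ≟ⁿ suc (toℕ a)) eq

      extend : ∀ {a b t} → a ⇝ b → Walk (vertex (p b)) t → Walk (vertex (p a)) t
      extend         stop        w = w
      extend {a} (next {a⁺ = a⁺} a⁺≡ a⇝) w = edge {p a} {q a} (along a) ◅ edge {q a} {p a⁺} (onward {a} {a⁺} a⁺≡) ◅ extend a⇝ w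

      main : ∀ {a} → a ⇝ last → Walk (vertex (p a)) (vertex (q last))
      main a⇝ = extend a⇝ (edge {p last} {q last} (along last) ◅ ε)

      tail : ∀ {a} → a ⇝ last → Walk (vertex (q a)) (vertex (q last))
      tail     stop                       = ε
      tail {a} (next {a⁺ = a⁺} a⁺≡ a⇝) = edge {q a} {p a⁺} (onward {a} {a⁺} a⁺≡) ◅ main a⇝

      main-edges : ∀ {a} (a⇝ : a ⇝ last) → edges (main a⇝) ≡ (vertex (p a) , vertex (q a)) ∷ edges (tail a⇝)
      main-edges stop       = refl
      main-edges (next _ _) = refl

      extend-weight : ∀ {a b t} (a⇝ : a ⇝ b) (w : Walk (vertex (p b)) t) → walkWeight graph (extend a⇝ w) ≡ walkWeight graph w
      extend-weight stop          w = refl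
      extend-weight (next _ a⇝) w = extend-weight a⇝ w

      -- level i increases along P_st and along a detour from p i to q i, so both
      -- are simple.
      level : Fin k → Role → ℕ
      level i (p a)  = 4 * toℕ a
      level i (q a)  = 4 * toℕ a + 3
      level i (v _)  = 4 * toℕ i + 1
      level i (v′ _) = 4 * toℕ i + 2
      level i _      = 0

      rank : Fin k → Fin n → ℕ
      rank i u = level i (role u)

      rank-< : ∀ i ρ σ → level i ρ < level i σ → rank i (vertex ρ) < rank i (vertex σ)
      rank-< i ρ σ = subst₂ (λ ρ σ → level i ρ < level i σ) (sym (role-vertex ρ)) (sym (role-vertex σ))

      p<q : ∀ i a → rank i (vertex (p a)) < rank i (vertex (q a))
      p<q i a = rank-< i (p a) (q a) (m<m+n _ (s≤s z≤n))

      q<p : ∀ i {a b} → toℕ b ≡ suc (toℕ a) → rank i (vertex (q a)) < rank i (vertex (p b))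
      q<p i {a} {b} eq = rank-< i (q a) (p b) (≤-reflexive
        (trans (sym (trans (*-suc 4 (toℕ a)) (trans (+-comm 4 _) (+-suc _ 3)))) (cong (4 *_) (sym eq))))

      extend-climbs : ∀ i {a b t} (a⇝ : a ⇝ b) (w : Walk (vertex (p b)) t) → Climbs (rank i) w → Climbs (rank i) (extend a⇝ w)
      extend-climbs i stop w climb = climb
      extend-climbs i {a} (next {a⁺ = a⁺} a⁺≡ a⇝) w climb = p<q i a , q<p i {a} {a⁺} a⁺≡ , extend-climbs i a⇝ w climb

      main-climbs : ∀ i {a} (a⇝ : a ⇝ last) → Climbs (rank i) (main a⇝)
      main-climbs i a⇝ = extend-climbs i a⇝ _ (p<q i last , tt)

      Pₛₜ : Path graph (vertex (p zero)) (vertex (q last))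
      Pₛₜ = record { walk = main (from-start last) ; simple = climbs⇒unique (rank zero) _ (main-climbs zero (from-start last)) }

      hardInstance : Instance n W
      hardInstance = record
        { graph    = graph
        ; source   = vertex (p zero)
        ; target   = vertex (q last)
        ; Pₛₜ      = Pₛₜ
        ; shortest = λ _ → ≤-trans (≤-reflexive (extend-weight (from-start last) _)) z≤n
        }

      Pₛₜ-edges : List (Fin n × Fin n)
      Pₛₜ-edges = Path.pathEdges Pₛₜ

      main-∋ : ∀ {a b} (a⇝ : a ⇝ last) → toℕ a ≤ toℕ b → (vertex (p b) , vertex (q b)) ∈ edges (main a⇝)
      main-∋ {b = b} stop a≤b
        with refl ← toℕ-injective {i = last} {j = b} (≤-antisym a≤b (≤-trans (toℕ≤pred[n] b) (≤-reflexive (sym (toℕ-fromℕ κ))))) = here refl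
      main-∋ {a} {b} (next a⁺≡ a⇝) a≤b with m≤n⇒m<n∨m≡n a≤b
      ... | inj₁ a<b = there (there (main-∋ a⇝ (≤-trans (≤-reflexive a⁺≡) a<b)))
      ... | inj₂ a≡b with refl ← toℕ-injective a≡b = here refl

      extend-∌ : ∀ {a b c t} (a⇝ : a ⇝ b) (w : Walk (vertex (p b)) t) →
                 toℕ b ≤ toℕ c → (vertex (p c) , vertex (q c)) ∉ edges w → (vertex (p c) , vertex (q c)) ∉ edges (extend a⇝ w)
      extend-∌ stop w b≤c avoids = avoids
      extend-∌ {a} {c = c} (next a⁺≡ a⇝) w b≤c avoids (here eq) with refl ← vertex-injective {p c} {p a} (cong proj₁ eq) =
        <⇒≱ (≤-reflexive (sym a⁺≡)) (≤-trans (⇝⇒≤ a⇝) b≤c)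
      extend-∌ {a} {c = c} (next a⁺≡ a⇝) w b≤c avoids (there (here eq)) with () ← vertex-injective {p c} {q a} (cong proj₁ eq)
      extend-∌ (next a⁺≡ a⇝) w b≤c avoids (there (there e∈)) = extend-∌ a⇝ w b≤c avoids e∈

      main-∌ : ∀ {a c} (a⇝ : a ⇝ last) → toℕ c < toℕ a → (vertex (p c) , vertex (q c)) ∉ edges (main a⇝)
      main-∌ {c = c} stop c<a (here eq) with refl ← vertex-injective {p c} {p last} (cong proj₁ eq) = <-irrefl refl c<a
      main-∌ {a} {c} (next a⁺≡ a⇝) c<a (here eq) with refl ← vertex-injective {p c} {p a} (cong proj₁ eq) = <-irrefl refl c<a
      main-∌ {a} {c} (next a⁺≡ a⇝) c<a (there (here eq)) with () ← vertex-injective {p c} {q a} (cong proj₁ eq)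
      main-∌ (next a⁺≡ a⇝) c<a (there (there e∈)) = main-∌ a⇝ (<-trans c<a (≤-reflexive (sym a⁺≡))) e∈

      module Detour {i j : Fin k} (x-bit : lookup x (combine i j) ≡ true) (y-bit : lookup y (combine i j) ≡ true) where

        leave : arc x y (p i) (v j) ≡ just (opposite i)
        leave rewrite x-bit = refl

        return : arc x y (v′ j) (q i) ≡ just i
        return rewrite y-bit = refl

        cross : arc x y (v j) (v′ j) ≡ just zero
        cross = when-true (j ≟ᶠ j) refl

        middle : i ⇝ last → Walk (vertex (p i)) (vertex (q last))
        middle i⇝ = edge {p i} {v j} leave ◅ edge {v j} {v′ j} cross ◅ edge {v′ j} {q i} return ◅ tail i⇝

        detour : Walk (vertex (p zero)) (vertex (q last))
        detour = extend (from-start i) (middle (to-end i))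

        tail-climbs : (i⇝ : i ⇝ last) → Climbs (rank i) (tail i⇝)
        tail-climbs stop                       = tt
        tail-climbs (next {a⁺ = a⁺} a⁺≡ a⇝) = q<p i {i} {a⁺} a⁺≡ , main-climbs i a⇝

        detour-climbs : Climbs (rank i) detour
        detour-climbs = extend-climbs i (from-start i) _
          ( rank-< i (p i) (v j) (m<m+n _ (s≤s z≤n)) , rank-< i (v j) (v′ j) (+-monoʳ-< (4 * toℕ i) (≤-refl {2}))
          , rank-< i (v′ j) (q i) (+-monoʳ-< (4 * toℕ i) (≤-refl {3})) , tail-climbs (to-end i))

        detourPath : Path graph (vertex (p zero)) (vertex (q last))
        detourPath = record { walk = detour ; simple = climbs⇒unique (rank i) detour detour-climbs }

        tail-weight : (i⇝ : i ⇝ last) → walkWeight graph (tail i⇝) ≡ 0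
        tail-weight stop        = refl
        tail-weight (next _ a⇝) = extend-weight a⇝ _

        detour-weight : Path.weight detourPath ≡ κ
        detour-weight = begin
          walkWeight graph detour
            ≡⟨ extend-weight (from-start i) _ ⟩
          toℕ (embed (opposite i)) + (toℕ (embed i) + walkWeight graph (tail (to-end i)))
            ≡⟨ cong₂ (λ a b → a + (b + walkWeight graph (tail (to-end i)))) (toℕ-inject≤ (opposite i) _) (toℕ-inject≤ i _) ⟩
          toℕ (opposite i) + (toℕ i + walkWeight graph (tail (to-end i)))
            ≡⟨ cong₂ (λ a b → a + (toℕ i + b)) (opposite-prop i) (tail-weight (to-end i)) ⟩
          κ ∸ toℕ i + (toℕ i + 0)
            ≡⟨ cong (κ ∸ toℕ i +_) (+-identityʳ (toℕ i)) ⟩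
          κ ∸ toℕ i + toℕ i
            ≡⟨ m∸n+n≡m (toℕ≤pred[n] i) ⟩
          κ ∎
          where open ≡-Reasoning

        tail-∌ : (i⇝ : i ⇝ last) → (vertex (p i) , vertex (q i)) ∉ edges (tail i⇝)
        tail-∌ (next _ _)      (here eq) with () ← vertex-injective {p i} {q i} (cong proj₁ eq)
        tail-∌ (next a⁺≡ a⇝) (there e∈) = main-∌ a⇝ (≤-reflexive (sym a⁺≡)) e∈

        detour-∌ : (vertex (p i) , vertex (q i)) ∉ Path.pathEdges detourPath
        detour-∌ = extend-∌ (from-start i) _ ≤-refl λ where
          (here eq)                 → contradiction (vertex-injective {q i} {v j} (cong proj₂ eq)) λ ()
          (there (here eq))         → contradiction (vertex-injective {p i} {v j} (cong proj₁ eq)) λ ()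
          (there (there (here eq))) → contradiction (vertex-injective {p i} {v′ j} (cong proj₁ eq)) λ ()
          (there (there (there e∈))) → tail-∌ (to-end i) e∈

      Bypass : ℕ → Set
      Bypass c = κ ≤ c × (c ≡ κ → Intersect x y)

      bypass-weight : ∀ {a i j c c′} → lookup x (combine a j) ≡ true → lookup y (combine i j) ≡ true → toℕ a ≤ toℕ i →
                      c ≡ toℕ (opposite a) → toℕ i ≤ c′ → Bypass (c + c′)
      bypass-weight {a} {i} {j} {c} {c′} x-bit y-bit a≤i c≡ i≤c′ = bound , tight
        where
        open ≤-Reasoning
        κ≡ : c + toℕ a ≡ κ
        κ≡ = trans (cong (_+ toℕ a) (trans c≡ (opposite-prop a))) (m∸n+n≡m (toℕ≤pred[n] a))
        bound : κ ≤ c + c′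
        bound = begin
          κ         ≡⟨ κ≡ ⟨
          c + toℕ a ≤⟨ +-monoʳ-≤ c (≤-trans a≤i i≤c′) ⟩
          c + c′    ∎
        tight : c + c′ ≡ κ → Intersect x y
        tight eq = combine a j , x-bit , subst (λ i → lookup y (combine i j) ≡ true) i≡a y-bit
          where
          c′≡a : c′ ≡ toℕ a
          c′≡a = +-cancelˡ-≡ c c′ (toℕ a) (trans eq (sym κ≡))
          i≡a : i ≡ a
          i≡a = toℕ-injective (≤-antisym (≤-trans i≤c′ (≤-reflexive c′≡a)) a≤i)

      Fresh : Fin k → ∀ {s t} → Walk s t → Set
      Fresh a w = ∀ b → toℕ b < toℕ a → vertex (q b) ∉ vertices w

      start∈ : ∀ {s t} (w : Walk s t) → s ∈ vertices w
      start∈ ε       = here refl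
      start∈ (_ ◅ _) = here refl

      hub-stuck : ∀ {t} → t ≡ vertex (q last) → ¬ Walk (vertex hub) t
      hub-stuck eq ε with () ← vertex-injective {hub} {q last} eq
      hub-stuck eq (e ◅ _) with _ , _ , _ , () , _ ← invert {hub} e

      from-v′ : ∀ a {j t} (w : Walk (vertex (v′ j)) t) → t ≡ vertex (q last) → Fresh a w →
                ∃ λ (i : Fin k) → lookup y (combine i j) ≡ true × toℕ a ≤ toℕ i × toℕ i ≤ walkWeight graph w
      from-v′ a {j} ε eq _ with () ← vertex-injective {v′ j} {q last} eq
      from-v′ a {j} (e ◅ w) eq fresh with invert {v′ j} e
      ... | hub , _ , refl , _ , _ = contradiction w (hub-stuck eq)
      ... | q i , _ , refl , arc≡ , c≡ with if-just (lookup y (combine i j)) arc≡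
      ... | y-bit , refl = i , y-bit , ≮⇒≥ (λ i<a → fresh i i<a (there (start∈ w))) ,
        ≤-trans (≤-reflexive (sym c≡)) (m≤m+n _ _)

      from-v : ∀ a {j t} (w : Walk (vertex (v j)) t) → t ≡ vertex (q last) → Fresh a w →
               ∃ λ (i : Fin k) → lookup y (combine i j) ≡ true × toℕ a ≤ toℕ i × toℕ i ≤ walkWeight graph w
      from-v a {j} ε eq _ with () ← vertex-injective {v j} {q last} eq
      from-v a {j} (e ◅ w) eq fresh with invert {v j} e
      ... | hub , _ , refl , _ , _ = contradiction w (hub-stuck eq)
      ... | v′ j′ , _ , refl , arc≡ , c≡ with when-just (j ≟ᶠ j′) arc≡
      ... | refl , _ with i , y-bit , a≤i , i≤ ← from-v′ a w eq (λ b b<a b∈ → fresh b b<a (there b∈)) =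
        i , y-bit , a≤i , ≤-trans i≤ (m≤n+m _ _)

      from-p : ∀ {a t} (a⇝ : a ⇝ last) (w : Walk (vertex (p a)) t) → t ≡ vertex (q last) → Unique (vertices w) → Fresh a w →
               (∀ e → e ∈ edges (main a⇝) → e ∈ edges w) ⊎ Bypass (walkWeight graph w)
      from-q : ∀ {a t} (a⇝ : a ⇝ last) (w : Walk (vertex (q a)) t) → t ≡ vertex (q last) → Unique (vertices w) → Fresh a w →
               (∀ e → e ∈ edges (tail a⇝) → e ∈ edges w) ⊎ Bypass (walkWeight graph w)
      from-p {a} a⇝ ε eq _ _ with () ← vertex-injective {p a} {q last} eq
      from-p {a} a⇝ (e ◅ w) eq (_ ∷ unique) fresh with invert {p a} e
      ... | hub , _ , refl , _ , _ = contradiction w (hub-stuck eq)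
      ... | v j , _ , refl , arc≡ , c≡ with if-just (lookup x (combine a j)) arc≡
      ... | x-bit , refl with i , y-bit , a≤i , i≤ ← from-v a w eq (λ b b<a b∈ → fresh b b<a (there b∈)) =
        inj₂ (bypass-weight {a} {i} {j} x-bit y-bit a≤i c≡ i≤)
      from-p {a} a⇝ (e ◅ w) eq (_ ∷ unique) fresh | q a′ , _ , refl , arc≡ , c≡ with when-just (a ≟ᶠ a′) arc≡
      ... | refl , refl with from-q a⇝ w eq unique (λ b b<a b∈ → fresh b b<a (there b∈))
      ... | inj₁ covers = inj₁ λ f f∈ → add (subst (f ∈_) (main-edges a⇝) f∈)
        where
        add : ∀ {f} → f ∈ (vertex (p a) , vertex (q a)) ∷ edges (tail a⇝) → f ∈ (vertex (p a) , vertex (q a)) ∷ edges w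
        add (here eq)  = here eq
        add (there f∈) = there (covers _ f∈)
      ... | inj₂ bypass = inj₂ (subst (λ c → Bypass (c + walkWeight graph w)) (sym c≡) bypass)
      from-q stop w _ _ _ = inj₁ λ _ ()
      from-q {a} (next a⁺≡ a⇝) ε eq _ _ with refl ← vertex-injective {q a} {q last} eq =
        contradiction (⇝⇒≤ a⇝) (<⇒≱ (≤-reflexive (sym a⁺≡)))
      from-q {a} (next a⁺≡ a⇝) (e ◅ w) eq (q∉ ∷ unique) fresh with invert {q a} e
      ... | hub , _ , refl , _ , _ = contradiction w (hub-stuck eq)
      ... | p b , _ , refl , arc≡ , c≡ with when-just (toℕ b ≟ⁿ suc (toℕ a)) arc≡
      ... | b≡ , refl with refl ← toℕ-injective (trans a⁺≡ (sym b≡)) with from-p a⇝ w eq unique fresh′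
        where
        fresh′ : Fresh b w
        fresh′ c c<b c∈ with m≤n⇒m<n∨m≡n (≤-pred (≤-trans c<b (≤-reflexive a⁺≡)))
        ... | inj₁ c<a = fresh c c<a (there c∈)
        ... | inj₂ c≡a with refl ← toℕ-injective c≡a = All.lookup q∉ c∈ refl
      ... | inj₁ covers = inj₁ λ where
        f (here eq)  → here eq
        f (there f∈) → there (covers f f∈)
      ... | inj₂ bypass = inj₂ (subst (λ c → Bypass (c + walkWeight graph w)) (sym c≡) bypass)

is-just-map : ∀ {A B : Set} (f : A → B) m → is-just (Maybe.map f m) ≡ is-just m
is-just-map f (just _) = refl
is-just-map f nothing  = refl

is-just-when : ∀ {A P : Set} (P? : Dec P) {a : A} → is-just (when P? a) ≡ true → P
is-just-when (yes p) _ = p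

∣good∣≤ : ∀ {m} (good : Subset m) {P : Fin m → Set} (P? : ∀ i → Dec (P i)) →
          (∀ i → i ∈ₛ good → P i) → ∣ good ∣ ≤ (∑[ i ∈ allFin m ] 𝟙 (P? i))
∣good∣≤ [] P? sub = z≤n
∣good∣≤ {suc m} (b ∷ good) P? sub rewrite ∑-allFin-suc m (λ i → 𝟙 (P? i))
  with ih ← ∣good∣≤ good (P? ∘ suc) (λ i i∈ → sub (suc i) (there i∈)) with b
... | false = ≤-trans ih (m≤n+m _ (𝟙 (P? zero)))
... | true with P? zero
...   | yes _ = s≤s ih
...   | no ¬p = contradiction (sub zero here) ¬p

∑+∣good∣≤ : ∀ {m} (good : Subset m) {P : Fin m → Set} (P? : ∀ i → Dec (P i)) →
            (∀ i → i ∈ₛ good → ¬ P i) → (∑[ i ∈ allFin m ] 𝟙 (P? i)) + ∣ good ∣ ≤ m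
∑+∣good∣≤ [] P? dis = z≤n
∑+∣good∣≤ {suc m} (b ∷ good) P? dis rewrite ∑-allFin-suc m (λ i → 𝟙 (P? i))
  with ih ← ∑+∣good∣≤ good (P? ∘ suc) (λ i i∈ → dis (suc i) (there i∈)) with b
... | false = ≤-trans (≤-reflexive (+-assoc (𝟙 (P? zero)) _ _)) (+-mono-≤ (𝟙≤1 (P? zero)) ih)
... | true with P? zero
...   | yes p = contradiction p (dis zero here)
...   | no _  = ≤-trans (≤-reflexive (+-suc _ _)) (s≤s ih)

module Reduction (κ r W : ℕ) (κ≤W : κ ≤ W) where

  open HardGraph κ r
  open Weighted W κ≤W
  open Graph using (graph; cell; extend; main; hardInstance; entry≡; Pₛₜ-edges; Pₛₜ; main-∋; Bypass; from-p)

  side : Fin n → Bool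
  side u = alice (role u)

  side-vertex : ∀ ρ → side (vertex ρ) ≡ alice ρ
  side-vertex ρ = cong alice (role-vertex ρ)

  extend-route : ∀ x y x′ y′ {a b t} (a⇝ : a ⇝ b) w w′ → vertices w ≡ vertices w′ →
                 vertices (extend x y {t = t} a⇝ w) ≡ vertices (extend x′ y′ {t = t} a⇝ w′)
  extend-route x y x′ y′ stop        w w′ eq = eq
  extend-route x y x′ y′ {a} (next _ a⇝) w w′ eq =
    cong (λ us → vertex (p a) ∷ vertex (q a) ∷ us) (extend-route x y x′ y′ a⇝ w w′ eq)

  view-cong : ∀ x y x′ y′ u → (∀ w → cell x y u w ≡ cell x′ y′ u w) → (∀ w → cell x y w u ≡ cell x′ y′ w u) →
              localView (hardInstance x y) u ≡ localView (hardInstance x′ y′) u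
  view-cong x y x′ y′ u out inc = assemble
    (tabulate-cong λ w → trans (entry≡ x y u w) (trans (out w) (sym (entry≡ x′ y′ u w))))
    (tabulate-cong λ w → trans (entry≡ x y w u) (trans (inc w) (sym (entry≡ x′ y′ w u))))
    (extend-route x y x′ y′ (from-start last) _ _ refl)
    where
    assemble : ∀ {s t : Fin n} {o o′ i i′ : Vec (Maybe (Fin (suc W))) n} {R R′ : List (Fin n)} → o ≡ o′ → i ≡ i′ → R ≡ R′ →
               localInput u o i s t R ≡ localInput u o′ i′ s t R′
    assemble refl refl refl = refl

  viewA : ∀ {u} x {y y′} → side u ≡ true → localView (hardInstance x y) u ≡ localView (hardInstance x y′) u
  viewA {u} x {y} {y′} s = view-cong x y x y′ u
    (λ w → cong (Maybe.map embed) (arc-y-free x y y′ (role u) (role w) (inj₁ s)))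
    (λ w → cong (Maybe.map embed) (arc-y-free x y y′ (role w) (role u) (inj₂ s)))

  viewB : ∀ {u x x′} y → side u ≡ false → localView (hardInstance x y) u ≡ localView (hardInstance x′ y) u
  viewB {u} {x} {x′} y s = view-cong x y x′ y u
    (λ w → cong (Maybe.map embed) (arc-x-free x x′ y (role u) (role w) (inj₁ s)))
    (λ w → cong (Maybe.map embed) (arc-x-free x x′ y (role w) (role u) (inj₂ s)))

  -- The five families of links across the cut: p_i q_i, q_(i-1) p_i, hub q_i, v_i v′_i
  -- and hub v′_i.  Since pred zero = zero, the second family repeats p_0 q_0.
  leftRole rightRole : Fin 5 × Fin k → Role
  leftRole (zero , i)                       = p i
  leftRole (suc zero , i)                   = p i
  leftRole (suc (suc zero) , i)             = hub
  leftRole (suc (suc (suc zero)) , i)       = v i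
  leftRole (suc (suc (suc (suc _))) , i)    = hub
  rightRole (zero , i)                      = q i
  rightRole (suc zero , i)                  = q (pred i)
  rightRole (suc (suc zero) , i)            = q i
  rightRole (suc (suc (suc zero)) , i)      = v′ i
  rightRole (suc (suc (suc (suc _))) , i)   = v′ i

  left-alice : ∀ e → alice (leftRole e) ≡ true
  left-alice (zero , i)                       = refl
  left-alice (suc zero , i)                   = refl
  left-alice (suc (suc zero) , i)             = refl
  left-alice (suc (suc (suc zero)) , i)       = refl
  left-alice (suc (suc (suc (suc _))) , i)    = refl

  right-bob : ∀ e → alice (rightRole e) ≡ false
  right-bob (zero , i)                       = refl
  right-bob (suc zero , i)                   = refl
  right-bob (suc (suc zero) , i)             = refl
  right-bob (suc (suc (suc zero)) , i)       = refl
  right-bob (suc (suc (suc (suc _))) , i)    = refl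

  left right : Fin (5 * k) → Fin n
  left  e = vertex (leftRole (remQuot k e))
  right e = vertex (rightRole (remQuot k e))

  cut-roles : ∀ x y ρ σ → alice ρ ≡ true → alice σ ≡ false → is-just (arc x y ρ σ) ∨ is-just (arc x y σ ρ) ≡ true →
              ∃ λ e → leftRole e ≡ ρ × rightRole e ≡ σ
  cut-roles x y hub       (q i)  _ _ _ = (suc (suc zero) , i) , refl , refl
  cut-roles x y hub       (v′ i) _ _ _ = (suc (suc (suc (suc zero))) , i) , refl , refl
  cut-roles x y (p a)     (q i)  _ _ link with a ≟ᶠ i
  ... | yes refl = (zero , i) , refl , refl
  ... | no _ with a | is-just-when (toℕ a ≟ⁿ suc (toℕ i)) link
  ...   | suc a′ | a≡ = (suc zero , suc a′) , refl ,
    cong q (toℕ-injective (trans (toℕ-inject₁ a′) (suc-injective a≡)))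
  cut-roles x y (p _)     (v′ _) _ _ ()
  cut-roles x y (v _)     (q _)  _ _ ()
  cut-roles x y (v i)     (v′ j) _ _ link
    with refl ← is-just-when (i ≟ᶠ j) (trans (sym (∨-comm (is-just (arc x y (v i) (v′ j))) false)) link) =
    (suc (suc (suc zero)) , i) , refl , refl
  cut-roles x y (spare _) (q _)  _ _ ()
  cut-roles x y (spare _) (v′ _) _ _ ()

  linked-roles : ∀ x y u w → Digraph.linked (graph x y) u w ≡ is-just (arc x y (role u) (role w)) ∨ is-just (arc x y (role w) (role u))
  linked-roles x y u w = cong₂ _∨_
    (trans (cong is-just (entry≡ x y u w)) (is-just-map embed (arc x y (role u) (role w))))
    (trans (cong is-just (entry≡ x y w u)) (is-just-map embed (arc x y (role w) (role u))))

  cut : ∀ x y u w → side u ≡ true → side w ≡ false → Digraph.linked (graph x y) u w ≡ true →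
        ∃ λ e → left e ≡ u × right e ≡ w
  cut x y u w su sw link
    with (t , i) , l≡ , r≡ ← cut-roles x y (role u) (role w) su sw (trans (sym (linked-roles x y u w)) link) =
    combine t i ,
    trans (cong (vertex ∘ leftRole) (remQuot-combine t i)) (trans (cong vertex l≡) (vertex-role u)) ,
    trans (cong (vertex ∘ rightRole) (remQuot-combine t i)) (trans (cong vertex r≡) (vertex-role w))

  link-hub : ∀ x y ρ → ρ ≢ hub → is-just (arc x y ρ hub) ≡ true
  link-hub x y hub       ρ≢ = contradiction refl ρ≢
  link-hub x y (p _)     _  = refl
  link-hub x y (q _)     _  = refl
  link-hub x y (v _)     _  = refl
  link-hub x y (v′ _)    _  = refl
  link-hub x y (spare _) _  = refl

  announcesκ : Maybe ℕ∞ → Bool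
  announcesκ (just (fin m)) = does (m ≟ⁿ κ)
  announcesκ _              = false

  module _ (x y : Bits) where

    open Digraph (graph x y)

    to-hub : ∀ u → (u ≡ vertex hub) ⊎ (Link u (vertex hub) × Link (vertex hub) u)
    to-hub u with u ≟ᶠ vertex hub
    ... | yes eq = inj₁ eq
    ... | no u≢ = inj₂ (subst T (sym there-link) tt , subst T (sym back-link) tt)
      where
      arc-u : is-just (arc x y (role u) (role (vertex hub))) ≡ true
      arc-u = trans (cong (λ σ → is-just (arc x y (role u) σ)) (role-vertex hub))
        (link-hub x y (role u) λ eq → u≢ (trans (sym (vertex-role u)) (cong vertex eq)))
      there-link : linked u (vertex hub) ≡ true
      there-link = trans (linked-roles x y u (vertex hub)) (cong (_∨ is-just (arc x y (role (vertex hub)) (role u))) arc-u)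
      back-link : linked (vertex hub) u ≡ true
      back-link = trans (linked-roles x y (vertex hub) u) (trans (cong (is-just (arc x y (role (vertex hub)) (role u)) ∨_) arc-u) (∨-zeroʳ _))

    two-steps : ∀ u w → Σ (Star Link u w) λ s → length s ≤ 2
    two-steps u w with to-hub u | to-hub w
    ... | inj₁ refl      | inj₁ refl       = ε , z≤n
    ... | inj₁ refl      | inj₂ (_ , b)    = (b ◅ ε) , s≤s z≤n
    ... | inj₂ (a , _)   | inj₁ refl       = (a ◅ ε) , s≤s z≤n
    ... | inj₂ (a , _)   | inj₂ (_ , b)    = (a ◅ b ◅ ε) , ≤-refl

    connected : Connected (graph x y)
    connected u w = proj₁ (two-steps u w)

    diameter-2 : UndirectedDiameter (graph x y) 2
    diameter-2 = two-steps , vertex (p zero) , vertex (v′ zero) , λ s → far s refl refl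
      where
      unlinked : linked (vertex (p zero)) (vertex (v′ zero)) ≡ false
      unlinked = trans (linked-roles x y (vertex (p zero)) (vertex (v′ zero)))
        (cong₂ (λ ρ σ → is-just (arc x y ρ σ) ∨ is-just (arc x y σ ρ)) (role-vertex (p zero)) (role-vertex (v′ zero)))
      far : ∀ {u w} (s : Star Link u w) → u ≡ vertex (p zero) → w ≡ vertex (v′ zero) → 2 ≤ length s
      far ε           refl eq   = contradiction (vertex-injective {p zero} {v′ zero} eq) λ ()
      far (l ◅ ε)     refl refl = contradiction (subst T unlinked l) λ ()
      far (_ ◅ _ ◅ _) _    _    = s≤s (s≤s z≤n)

    open Answer

    omits⇒bypass : ∀ (s : Path (graph x y) (vertex (p zero)) (vertex (q last))) →
                   (∃ λ e → e ∈ Pₛₜ-edges x y × e ∉ Path.pathEdges s) → Bypass x y (Path.weight s)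
    omits⇒bypass s (e , e∈ , e∉) with from-p x y (from-start last) (Path.walk s) refl (Path.simple s) (λ _ ())
    ... | inj₁ covers = contradiction (covers e e∈) e∉
    ... | inj₂ bypass = bypass

    module _ (ans : Fin n → Answer n) (Q : Path (graph x y) (vertex (p zero)) (vertex (q last)) → Set)
             (omits : ∀ s → Q s → ∃ λ e → e ∈ Pₛₜ-edges x y × e ∉ Path.pathEdges s) where

      disjoint⇒silent : FindsShortest ans (graph x y) Q → ¬ Intersect x y → ∀ u → announcesκ (announced (ans u)) ≡ false
      disjoint⇒silent found disjoint u with announced (ans u) in eq
      ... | nothing      = refl
      ... | just ∞       = refl
      ... | just (fin m) with m ≟ⁿ κ
      ...   | no m≢κ = dec-false (m ≟ⁿ κ) m≢κ
      ...   | yes m≡κ with found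
      ...     | inj₁ (s , (Qs , _) , (_ , only) , _) with refl ← only u (fin m) eq =
        contradiction (proj₂ (omits⇒bypass s (omits s Qs)) m≡κ) disjoint
      ...     | inj₂ (_ , (_ , only)) with () ← only u (fin m) eq

      intersect⇒announced : FindsShortest ans (graph x y) Q → (∃ λ s → Q s × Path.weight s ≡ κ) → ∃ λ u → announcesκ (announced (ans u)) ≡ true
      intersect⇒announced found (s , Qs , s≡κ) with found
      ... | inj₂ (none , _) = contradiction Qs (none s)
      ... | inj₁ (s′ , (Qs′ , least) , ((u , says) , _) , _) = u ,
        trans (cong announcesκ says) (dec-true (Path.weight s′ ≟ⁿ κ)
          (≤-antisym (≤-trans (least s Qs) (≤-reflexive s≡κ)) (proj₁ (omits⇒bypass s′ (omits s′ Qs′)))))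

  Detects : (Π : Problem) → (Problem.Output Π n → Bool) → Set
  Detects Π claims = ∀ x y (out : Fin n → Problem.Output Π n) → Problem.Correct Π (hardInstance x y) out →
    (¬ Intersect x y → ∀ u → claims (out u) ≡ false) × (Intersect x y → ∃ λ u → claims (out u) ≡ true)

  open Answer

  claims-2-SiSP : Answer n → Bool
  claims-2-SiSP a = announcesκ (announced a)

  detects-2-SiSP : Detects 2-SiSP claims-2-SiSP
  detects-2-SiSP x y out found = disjoint⇒silent x y out _ (λ _ Q → Q) found , λ (c , x-bit , y-bit) → hit c x-bit y-bit
    where
    hit : ∀ c → lookup x c ≡ true → lookup y c ≡ true → ∃ λ u → claims-2-SiSP (out u) ≡ true
    hit c x-bit y-bit with i , j , refl ← combine-surjective {k} {k} c =
      intersect⇒announced x y out _ (λ _ Q → Q) found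
        (detourPath , (_ , main-∋ x y (from-start last) z≤n , detour-∌) , detour-weight)
      where open Graph.Detour x y {i} {j} x-bit y-bit

  claims-RPaths? : (a : Fin n × Fin n → Answer n) →
                   Dec (∃ λ i → announcesκ (announced (a (vertex (p i) , vertex (q i)))) ≡ true)
  claims-RPaths? a = any? λ i → announcesκ (announced (a (vertex (p i) , vertex (q i)))) ≟ᵇ true

  claims-RPaths : (Fin n × Fin n → Answer n) → Bool
  claims-RPaths a = does (claims-RPaths? a)

  detects-RPaths : Detects RPaths claims-RPaths
  detects-RPaths x y out found = quiet , λ (c , x-bit , y-bit) → hit c x-bit y-bit
    where
    e : Fin k → Fin n × Fin n
    e i = vertex (p i) , vertex (q i)
    e∈ : ∀ i → e i ∈ Pₛₜ-edges x y
    e∈ i = main-∋ x y (from-start last) z≤n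
    quiet : ¬ Intersect x y → ∀ u → claims-RPaths (out u) ≡ false
    quiet disjoint u = dec-false (claims-RPaths? (out u)) λ (i , says) → contradiction (trans (sym says)
      (disjoint⇒silent x y (λ u → out u (e i)) _ (λ _ avoids → e i , e∈ i , avoids) (found (e i) (e∈ i)) disjoint u)) λ ()
    hit : ∀ c → lookup x c ≡ true → lookup y c ≡ true → ∃ λ u → claims-RPaths (out u) ≡ true
    hit c x-bit y-bit with i , j , refl ← combine-surjective {k} {k} c
      with u , says ← intersect⇒announced x y (λ u → out u (e i)) _ (λ _ avoids → e i , e∈ i , avoids) (found (e i) (e∈ i))
                        (Graph.Detour.detourPath x y {i} {j} x-bit y-bit , Graph.Detour.detour-∌ x y {i} {j} x-bit y-bit ,
                         Graph.Detour.detour-weight x y {i} {j} x-bit y-bit) =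
      u , dec-true (claims-RPaths? (out u)) (i , says)

  module _ {Π : Problem} {L : ℕ} (A : Protocol (Problem.Output Π n) n W L) (claims : Problem.Output Π n → Bool)
           (detects : Detects Π claims)
           (solves : ∀ x y → SucceedsWithProb≥⅔ A (hardInstance x y) (Problem.Correct Π (hardInstance x y))) where

    open Protocol A using (randomness; rounds)
    open Simulation A hardInstance side viewA viewB left right
      (λ e → trans (side-vertex (leftRole (remQuot k e))) (left-alice (remQuot k e)))
      (λ e → trans (side-vertex (rightRole (remQuot k e))) (right-bob (remQuot k e)))
      cut claims

    instance
      Ω≢0 : NonZero Ω
      Ω≢0 = m^n≢0 randomness n

    open Disjointness {k * k} {K} {Ω} transcript (Silent true) (Silent false) (Silent? true) (Silent? false) paste

    many : ∀ x y → ¬ Intersect x y → 2 * Ω ≤ 3 * (∑[ ω ∈ allFin Ω ] accepts ω x y)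
    many x y disjoint with good , large , correct ← solves x y = ≤-trans large
      (*-monoʳ-≤ 3 (∣good∣≤ good (λ ω → Silent? true ω x y ×-dec Silent? false ω x y) λ ω ω∈ →
        let silent = proj₁ (detects x y _ (correct ω ω∈)) disjoint in (λ u _ → silent u) , (λ u _ → silent u)))

    few : ∀ x y → Intersect x y → 3 * (∑[ ω ∈ allFin Ω ] accepts ω x y) ≤ Ω
    few x y intersect with good , large , correct ← solves x y =
      few-arith (∑[ ω ∈ allFin Ω ] accepts ω x y) ∣ good ∣ Ω
        (∑+∣good∣≤ good (λ ω → Silent? true ω x y ×-dec Silent? false ω x y) λ ω ω∈ (quietA , quietB) →
          loud ω quietA quietB (proj₂ (detects x y _ (correct ω ω∈)) intersect)) large
      where
      few-arith : ∀ s g o → s + g ≤ o → 2 * o ≤ 3 * g → 3 * s ≤ o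
      few-arith s g o s+g≤o 2o≤3g = +-cancelʳ-≤ (2 * o) (3 * s) o (begin
        3 * s + 2 * o   ≤⟨ +-monoʳ-≤ (3 * s) 2o≤3g ⟩
        3 * s + 3 * g   ≡⟨ *-distribˡ-+ 3 s g ⟨
        3 * (s + g)     ≤⟨ *-monoʳ-≤ 3 s+g≤o ⟩
        3 * o           ∎)
        where open ≤-Reasoning
      loud : ∀ ω → Silent true ω x y → Silent false ω x y →
             ¬ (∃ λ u → claims (outputs A (hardInstance x y) (finToFun ω) u) ≡ true)
      loud ω quietA quietB (u , says) with side u in s
      ... | true  = contradiction (trans (sym says) (quietA u s)) λ ()
      ... | false = contradiction (trans (sym says) (quietB u s)) λ ()

    transcripts-bound : ∀ m → 128 * (36 * m) ≤ k * k → 2 * 2 ^ m ≤ 3 * 128 * ((3 ^ L * 3 ^ L) ^ (5 * k)) ^ rounds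
    transcripts-bound = many-transcripts many few

few-bits : ∀ m L k R → 2 * 2 ^ m ≤ 3 * 128 * ((3 ^ L * 3 ^ L) ^ (5 * k)) ^ R → suc m ≤ 9 + 4 * L * (5 * k) * R
few-bits m L k R le = ≮⇒≥ λ big → <⇒≱ (^-monoʳ-< 2 (s≤s (s≤s z≤n)) big) (begin
  2 * 2 ^ m                                      ≤⟨ le ⟩
  3 * 128 * ((3 ^ L * 3 ^ L) ^ (5 * k)) ^ R      ≤⟨ *-mono-≤ {3 * 128} {2 ^ 9} (≤ᵇ⇒≤ _ _ tt) power ⟩
  2 ^ 9 * 2 ^ (4 * L * (5 * k) * R)              ≡⟨ ^-distribˡ-+-* 2 9 (4 * L * (5 * k) * R) ⟨
  2 ^ (9 + 4 * L * (5 * k) * R)                  ∎)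
  where
  open ≤-Reasoning
  base : 3 ^ L * 3 ^ L ≤ 2 ^ (4 * L)
  base = begin
    3 ^ L * 3 ^ L       ≤⟨ *-mono-≤ (^-monoˡ-≤ L (≤ᵇ⇒≤ 3 4 tt)) (^-monoˡ-≤ L (≤ᵇ⇒≤ 3 4 tt)) ⟩
    4 ^ L * 4 ^ L       ≡⟨ ^-distribʳ-* L 4 4 ⟨
    (2 ^ 4) ^ L         ≡⟨ ^-*-assoc 2 4 L ⟩
    2 ^ (4 * L)         ∎
  power : ((3 ^ L * 3 ^ L) ^ (5 * k)) ^ R ≤ 2 ^ (4 * L * (5 * k) * R)
  power = begin
    ((3 ^ L * 3 ^ L) ^ (5 * k)) ^ R  ≤⟨ ^-monoˡ-≤ R (^-monoˡ-≤ (5 * k) base) ⟩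
    ((2 ^ (4 * L)) ^ (5 * k)) ^ R    ≡⟨ cong (_^ R) (^-*-assoc 2 (4 * L) (5 * k)) ⟩
    (2 ^ (4 * L * (5 * k))) ^ R      ≡⟨ ^-*-assoc 2 (4 * L * (5 * k)) R ⟩
    2 ^ (4 * L * (5 * k) * R)        ∎

few-vertices : ∀ M m L k R → .{{_ : NonZero k}} → k * k < M * suc m → suc m ≤ 9 + 4 * L * (5 * k) * R → M * 9 ≤ k →
               k ≤ M * (20 * (L * R))
few-vertices M m L k R kk< m≤ 9M≤k = ≤-pred (*-cancelʳ-< k k (suc (M * (20 * (L * R)))) (begin-strict
  k * k                                     <⟨ kk< ⟩
  M * suc m                                 ≤⟨ *-monoʳ-≤ M m≤ ⟩
  M * (9 + 4 * L * (5 * k) * R)             ≡⟨ e M L k R ⟩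
  M * 9 + M * (20 * (L * R)) * k            ≤⟨ +-monoˡ-≤ _ 9M≤k ⟩
  k + M * (20 * (L * R)) * k                ∎))
  where
  open ≤-Reasoning
  e : ∀ M L k R → M * (9 + 4 * L * (5 * k) * R) ≡ M * 9 + M * (20 * (L * R)) * k
  e = solve-∀

decompose : ∀ n → 5 ≤ n → ∃₂ λ κ r → r ≤ 3 × n ≡ HardGraph.n κ r
decompose (suc n) (s≤s 4≤n) with n / 4 | n % 4 | m≡m%n+[m/n]*n n 4 | m%n<n n 4
... | zero  | r | refl | s≤s r≤3 = contradiction (≤-trans 4≤n (≤-trans (≤-reflexive (+-identityʳ r)) r≤3)) λ { (s≤s (s≤s (s≤s ()))) }
... | suc κ | r | refl | s≤s r≤3 = κ , r , r≤3 , cong suc (e r (suc κ))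
  where
  e : ∀ r k → r + k * 4 ≡ k + (k + (k + (k + r)))
  e = solve-∀

n≤8k : ∀ κ r → r ≤ 3 → HardGraph.n κ r ≤ 8 * suc κ
n≤8k κ r r≤3 = begin
  suc (k + (k + (k + (k + r))))    ≤⟨ s≤s (+-monoʳ-≤ k (+-monoʳ-≤ k (+-monoʳ-≤ k (+-monoʳ-≤ k r≤3)))) ⟩
  suc (k + (k + (k + (k + 3))))    ≡⟨ e k ⟩
  4 * k + 4 * 1                    ≤⟨ +-monoʳ-≤ (4 * k) (*-monoʳ-≤ 4 {1} {k} (s≤s z≤n)) ⟩
  4 * k + 4 * k                    ≡⟨ *-distribʳ-+ k 4 4 ⟨
  8 * k                            ∎
  where
  open ≤-Reasoning
  k = suc κ
  e : ∀ k → suc (k + (k + (k + (k + 3)))) ≡ 4 * k + 4 * 1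
  e = solve-∀

m<n*suc[m/n] : ∀ m n .{{_ : NonZero n}} → m < n * suc (m / n)
m<n*suc[m/n] m n = begin-strict
  m                      ≡⟨ m≡m%n+[m/n]*n m n ⟩
  m % n + m / n * n      <⟨ +-monoˡ-< (m / n * n) (m%n<n m n) ⟩
  n + m / n * n          ≡⟨ *-comm (suc (m / n)) n ⟩
  n * suc (m / n)        ∎
  where open ≤-Reasoning

ab[m/ab]≤m : ∀ a b m .{{_ : NonZero (a * b)}} → a * (b * (m / (a * b))) ≤ m
ab[m/ab]≤m a b m = ≤-trans (≤-reflexive (trans (sym (*-assoc a b _)) (*-comm (a * b) _))) (m/n*n≤m m (a * b))

size-bound : ∀ M κ r L R b ℓ → r ≤ 3 → 8 * (M * 9) ≤ HardGraph.n κ r → L ≡ b * ℓ →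
             ∀ m → suc κ * suc κ < M * suc m → suc m ≤ 9 + 4 * L * (5 * suc κ) * R →
             HardGraph.n κ r ≤ 8 * (M * 20) * b * (R * ℓ)
size-bound M κ r L R b ℓ r≤3 large refl m kk< m≤ = begin
  HardGraph.n κ r                        ≤⟨ n≤8k κ r r≤3 ⟩
  8 * suc κ
    ≤⟨ *-monoʳ-≤ 8 (few-vertices M m L (suc κ) R kk< m≤ (*-cancelˡ-≤ 8 (≤-trans large (n≤8k κ r r≤3)))) ⟩
  8 * (M * (20 * (b * ℓ * R)))           ≡⟨ e M b ℓ R ⟩
  8 * (M * 20) * b * (R * ℓ)             ∎
  where
  open ≤-Reasoning
  e : ∀ M b ℓ R → 8 * (M * (20 * (b * ℓ * R))) ≡ 8 * (M * 20) * b * (R * ℓ)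
  e = solve-∀

lower-bound : (Π : Problem) (𝒞 : GraphClass) →
  (∀ κ r W κ≤W → ∃ (Reduction.Detects κ r W κ≤W Π)) →
  (∀ κ r W κ≤W x y → 𝒞 (HardGraph.Weighted.Graph.graph κ r W κ≤W x y)) →
  RequiresΩ[n/logn] Π 𝒞
lower-bound Π 𝒞 detector hard∈𝒞 = 1 , λ a 1≤a b → 8 * (128 * 36 * 20) * b , 8 * (128 * 36 * 9) , λ A solves n N≤n →
  bound a 1≤a b A solves n N≤n (decompose n (≤-trans (≤ᵇ⇒≤ 5 (8 * (128 * 36 * 9)) tt) N≤n))
  where
  bound : ∀ a → 1 ≤ a → ∀ b (A : Algorithm Π (λ n → n ^ a) (λ n → b * ⌈log₂ n ⌉)) → Solves Π A 𝒞 →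
          ∀ n → 8 * (128 * 36 * 9) ≤ n → (∃₂ λ κ r → r ≤ 3 × n ≡ HardGraph.n κ r) →
          n ≤ 8 * (128 * 36 * 20) * b * (Protocol.rounds (A n) * ⌈log₂ n ⌉)
  bound a 1≤a b A solves n N≤n (κ , r , r≤3 , refl) =
    size-bound (128 * 36) κ r (b * ⌈log₂ n ⌉) R b ⌈log₂ n ⌉ r≤3 N≤n refl m (m<n*suc[m/n] (suc κ * suc κ) (128 * 36))
      (few-bits m (b * ⌈log₂ n ⌉) (suc κ) R
        (Reduction.transcripts-bound κ r (n ^ a) κ≤W {Π} (A n) (proj₁ detects) (proj₂ detects)
          (λ x y → solves n _ (hard∈𝒞 κ r (n ^ a) κ≤W x y))
          m (ab[m/ab]≤m 128 36 (suc κ * suc κ))))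
    where
    R = Protocol.rounds (A n)
    m = suc κ * suc κ / (128 * 36)
    κ≤W : κ ≤ n ^ a
    κ≤W = ≤-trans (≤-trans (n≤1+n κ) (≤-trans (m≤m+n (suc κ) _) (n≤1+n _)))
            (≤-trans (≤-reflexive (sym (^-identityʳ n))) (^-monoʳ-≤ n 1≤a))
    detects = detector κ r (n ^ a) κ≤W

theorem1 : (RequiresΩ[n/logn] RPaths Connected ×
    (∃ λ D → RequiresΩ[n/logn] RPaths (λ G → UndirectedDiameter G D))) ×
    (RequiresΩ[n/logn] 2-SiSP Connected ×
    (∃ λ D → RequiresΩ[n/logn] 2-SiSP (λ G → UndirectedDiameter G D)))
theorem1 =
  ( lower-bound RPaths Connected detect-RPaths Reduction.connected
  , 2 , lower-bound RPaths (λ G → UndirectedDiameter G 2) detect-RPaths Reduction.diameter-2) ,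
  ( lower-bound 2-SiSP Connected detect-2-SiSP Reduction.connected
  , 2 , lower-bound 2-SiSP (λ G → UndirectedDiameter G 2) detect-2-SiSP Reduction.diameter-2)
  where
  detect-RPaths : ∀ κ r W κ≤W → ∃ (Reduction.Detects κ r W κ≤W RPaths)
  detect-RPaths κ r W κ≤W = Reduction.claims-RPaths κ r W κ≤W , Reduction.detects-RPaths κ r W κ≤W
  detect-2-SiSP : ∀ κ r W κ≤W → ∃ (Reduction.Detects κ r W κ≤W 2-SiSP)
  detect-2-SiSP κ r W κ≤W = Reduction.claims-2-SiSP κ r W κ≤W , Reduction.detects-2-SiSP κ r W κ≤W
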